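{- There is a deterministic polynomial-time algorithm that, given a set $S$ of $n$ permutations over $[d]$, finds a $1.999$-approximate median of $S$ under the Ulam metric, i.e., a permutation $z\in\mathcal{S}_d$ with $\sum_{x\in S}\Delta(x,z)\le 1.999\cdot\min_{y\in\mathcal{S}_d}\sum_{x\in S}\Delta(x,y)$.
   Context: $[d]=\{1,\dots,d\}$ and $\mathcal{S}_d$ is the set of all permutations of $[d]$, viewed as sequences of length $d$. The Ulam distance $\Delta(x,y)$ between $x,y\in\mathcal{S}_d$ is the minimum number of character-move operations (pick up one symbol and reinsert it at another position) transforming $x$ into $y$; equivalently $\Delta(x,y)=d-|\mathrm{LCS}(x,y)|$, where $\mathrm{LCS}(x,y)$ is a longest common subsequence. Polynomial time means polynomial in $n$ and $d$. -}

module Defs where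

open import Data.Nat using (ℕ; zero; suc; _+_; _*_; _≤_; z≤n; s≤s; _≡ᵇ_)
import Data.Nat.Properties as ℕₚ
open import Data.Integer using (+_)
import Data.Rational.Unnormalised as ℚᵘ
open ℚᵘ using (ℚᵘ)
open import Data.Fin using (Fin; zero; suc)
open import Data.Fin.Properties using (any?)
open import Data.Bool using (if_then_else_)
open import Data.List using (List; []; _∷_; map; length; lookup; removeAt; insertAt; applyUpTo)
open import Data.Nat.ListAction using (sum)
open import Data.List.Properties using (≡-dec)
open import Data.List.Relation.Binary.Permutation.Propositional
  using (_↭_; refl; prep; swap; trans; ↭-sym)
open import Data.List.Relation.Unary.Unique.Propositional using (Unique)
open import Data.Product using (∃; ∃₂; _×_; _,_; proj₁)
open import Relation.Binary.PropositionalEquality using (_≡_; refl)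
open import Relation.Nullary using (Dec; yes; no; contradiction)

[1‥_] : ℕ → List ℕ
[1‥ d ] = applyUpTo suc d

record Perm (d : ℕ) : Set where
  constructor perm
  field
    seq    : List ℕ
    isPerm : seq ↭ [1‥ d ]
open Perm public

-- Two elements of Perm d are the same permutation when their sequences are
-- equal; a finite set of permutations is a list without repetitions in this
-- sense.
Distinct : ∀ {d} → List (Perm d) → Set
Distinct S = Unique (map seq S)

-- Pick up the symbol at position i and reinsert it at position j of the
-- remaining sequence.
move : (x : List ℕ) (i : Fin (length x)) → Fin (suc (length (removeAt x i))) → List ℕ
move x i j = insertAt (removeAt x i) j (lookup x i)

-- Moves k x y: some sequence of exactly k character moves turns x into y.
Moves : ℕ → List ℕ → List ℕ → Set
Moves zero    x y = x ≡ y
Moves (suc k) x y = ∃₂ λ i j → Moves k (move x i j) y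

moves? : ∀ k x y → Dec (Moves k x y)
moves? zero    x y = ≡-dec ℕₚ._≟_ x y
moves? (suc k) x y = any? λ i → any? λ j → moves? k (move x i j) y

moves-trans : ∀ k {l x y z} → Moves k x y → Moves l y z → Moves (k + l) x z
moves-trans zero    refl        q = q
moves-trans (suc k) (i , j , p) q = i , j , moves-trans k p q

moves-cons : ∀ k a {x y} → Moves k x y → Moves k (a ∷ x) (a ∷ y)
moves-cons zero    a refl        = refl
moves-cons (suc k) a (i , j , p) = suc i , suc j , moves-cons k a p

↭⇒moves : ∀ {x y} → x ↭ y → ∃ λ k → Moves k x y
↭⇒moves refl = 0 , refl
↭⇒moves (prep a p) with ↭⇒moves p
... | k , q = k , moves-cons k a q
↭⇒moves (swap a b p) with ↭⇒moves p
... | k , q = suc k , suc zero , zero , moves-cons k b (moves-cons k a q)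
↭⇒moves (trans p q) with ↭⇒moves p | ↭⇒moves q
... | k , r | l , s = k + l , moves-trans k r s

least : ∀ {P : ℕ → Set} n → (∀ k → Dec (P k)) → P n → ∃ λ k → P k × (∀ j → P j → k ≤ j)
least n P? pn with P? 0
least n       P? pn | yes p0 = 0 , p0 , λ _ _ → z≤n
least zero    P? p0 | no ¬p0 = contradiction p0 ¬p0
least (suc n) P? pn | no ¬p0 with least n (λ k → P? (suc k)) pn
... | k , pk , min =
  suc k , pk , λ { zero p0 → contradiction p0 ¬p0 ; (suc j) pj → s≤s (min j pj) }

minMoves : ∀ {d} (x y : Perm d) →
  ∃ λ k → Moves k (seq x) (seq y) × (∀ j → Moves j (seq x) (seq y) → k ≤ j)
minMoves x y with ↭⇒moves (trans (isPerm x) (↭-sym (isPerm y)))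
... | n , p = least n (λ k → moves? k (seq x) (seq y)) p

Δ : ∀ {d} → Perm d → Perm d → ℕ
Δ x y = proj₁ (minMoves x y)

cost : ∀ {d} → List (Perm d) → Perm d → ℕ
cost S z = sum (map (λ x → Δ x z) S)

ℕ→ℚᵘ : ℕ → ℚᵘ
ℕ→ℚᵘ k = + k ℚᵘ./ 1

-- cost S z ≤ α · min_y cost S y, for α ≥ 0: the minimum is attained, so this
-- says that cost S z ≤ α · cost S y for every y.
IsApproxMedian : ∀ {d} → ℚᵘ → List (Perm d) → Perm d → Set
IsApproxMedian α S z = ∀ y → ℕ→ℚᵘ (cost S z) ℚᵘ.≤ α ℚᵘ.* ℕ→ℚᵘ (cost S y)

-- The model of computation is Jones' imperative language WHILE over binary
-- trees.  With the time measure below (unit cost for each variable access, tree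
-- constructor, destructor, assignment and test) it decides in polynomial time
-- exactly what Turing machines do.  There is no arithmetic, so the measure
-- hides no cost of operations on large numbers.

infixr 5 _∙_

data Tree : Set where
  nil : Tree
  _∙_ : Tree → Tree → Tree

Var : Set
Var = ℕ

Store : Set
Store = Var → Tree

_[_↦_] : Store → Var → Tree → Store
(σ [ v ↦ t ]) w = if v ≡ᵇ w then t else σ w

data Expr : Set where
  var   : Var → Expr
  nil   : Expr
  cons  : Expr → Expr → Expr
  hd tl : Expr → Expr

left right : Tree → Tree
left  nil     = nil
left  (l ∙ r) = l
right nil     = nil
right (l ∙ r) = r

⟦_⟧ : Expr → Store → Tree
⟦ var v ⟧    σ = σ v
⟦ nil ⟧      σ = nil
⟦ cons e f ⟧ σ = ⟦ e ⟧ σ ∙ ⟦ f ⟧ σ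
⟦ hd e ⟧     σ = left (⟦ e ⟧ σ)
⟦ tl e ⟧     σ = right (⟦ e ⟧ σ)

time : Expr → ℕ
time (var v)    = 1
time nil        = 1
time (cons e f) = suc (time e + time f)
time (hd e)     = suc (time e)
time (tl e)     = suc (time e)

infix  6 _≔_
infixr 5 _⨾_

data Cmd : Set where
  _≔_   : Var → Expr → Cmd
  _⨾_   : Cmd → Cmd → Cmd
  cond  : Expr → Cmd → Cmd → Cmd
  while : Expr → Cmd → Cmd

-- c , σ ⇓[ t ] τ: started in store σ, the command c halts in store τ after
-- time t.  The tree nil means false and every other tree means true.  The
-- language is deterministic: c and σ determine t and τ.
infix 4 _,_⇓[_]_

data _,_⇓[_]_ : Cmd → Store → ℕ → Store → Set where
  assign  : ∀ {v e σ} → (v ≔ e) , σ ⇓[ suc (time e) ] (σ [ v ↦ ⟦ e ⟧ σ ])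
  comp    : ∀ {c c′ σ ρ τ t t′} →
            c , σ ⇓[ t ] ρ → c′ , ρ ⇓[ t′ ] τ → (c ⨾ c′) , σ ⇓[ t + t′ ] τ
  condT   : ∀ {e c c′ σ τ t l r} → ⟦ e ⟧ σ ≡ l ∙ r →
            c , σ ⇓[ t ] τ → cond e c c′ , σ ⇓[ suc (time e + t) ] τ
  condF   : ∀ {e c c′ σ τ t} → ⟦ e ⟧ σ ≡ nil →
            c′ , σ ⇓[ t ] τ → cond e c c′ , σ ⇓[ suc (time e + t) ] τ
  whileT  : ∀ {e c σ ρ τ t t′ l r} → ⟦ e ⟧ σ ≡ l ∙ r →
            c , σ ⇓[ t ] ρ → while e c , ρ ⇓[ t′ ] τ →
            while e c , σ ⇓[ suc (time e + t + t′) ] τ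
  whileF  : ∀ {e c σ} → ⟦ e ⟧ σ ≡ nil → while e c , σ ⇓[ suc (time e) ] σ

-- Input and output are both held in variable 0; all other variables start
-- out as nil.
initial : Tree → Store
initial t = (λ _ → nil) [ 0 ↦ t ]

Computes : Cmd → Tree → Tree → ℕ → Set
Computes c input output bound =
  ∃₂ λ t τ → c , initial input ⇓[ t ] τ × τ 0 ≡ output × t ≤ bound

-- Unary numerals: every encoded number is at most d, so this does not affect
-- being polynomial in n and d.
encℕ : ℕ → Tree
encℕ zero    = nil
encℕ (suc k) = nil ∙ encℕ k

encList : {A : Set} → (A → Tree) → List A → Tree
encList enc []       = nil
encList enc (a ∷ as) = enc a ∙ encList enc as

encPerm : ∀ {d} → Perm d → Tree
encPerm x = encList encℕ (seq x)

encInput : (d : ℕ) → List (Perm d) → Tree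
encInput d S = encℕ d ∙ encList encPerm S

data Poly : Set where
  const     : ℕ → Poly
  𝕟 𝕕       : Poly
  _⊕_ _⊗_   : Poly → Poly → Poly

evalPoly : Poly → (n d : ℕ) → ℕ
evalPoly (const k) n d = k
evalPoly 𝕟         n d = n
evalPoly 𝕕         n d = d
evalPoly (p ⊕ q)   n d = evalPoly p n d + evalPoly q n d
evalPoly (p ⊗ q)   n d = evalPoly p n d * evalPoly q n d

-- A single program and a single polynomial serve all n, d and S.
PolyTimeApproxMedian : ℚᵘ → Cmd → Set
PolyTimeApproxMedian α c =
  ∃ λ (p : Poly) → ∀ (n d : ℕ) (S : List (Perm d)) → length S ≡ n → Distinct S →
    ∃ λ (z : Perm d) →
      Computes c (encInput d S) (encPerm z) (evalPoly p n d) × IsApproxMedian α S z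

{-# OPTIONS --safe #-}
-- Fix a median y and, for every x ∈ S, an optimal sequence of moves from x to
-- y; call a symbol bad if at least a quarter of the x move it, and let B be
-- the total number of moves of bad symbols.
--
-- Two good symbols are ordered by a majority vote of S as in y.  Insert the
-- symbols one by one into a list ordered by the vote, discarding three
-- symbols whenever the vote is inconsistent on them; every discarded triple
-- contains a bad symbol.  The list followed by the discarded symbols is thus
-- within 3 · #bad of y, and as n · #bad ≤ 4 B it costs at most OPT + 12 B.
--
-- If x and x′ move I and I′, then Δ x x′ ≤ |I ∪ I′| = |I| + |I′| − |I ∩ I′|.
-- Summing over all pairs, some x ∈ S costs at most 2 OPT − B / 4.  Of these two
-- candidates the better one costs at most (OPT + 12 B + 48 (2 OPT − B / 4)) / 49
-- = 97/49 OPT.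
--
-- The algorithm is written in a small language whose only loop is a fold cut
-- off after n or d steps, so that its running time is bounded by a polynomial
-- read off the syntax.
module Submission where

open import Defs
open import Data.Bool using (Bool; true; false; not; _∧_; if_then_else_; T)
open import Data.Bool.ListAction using (any)
open import Data.Bool.Properties using (T?; T-≡)
open import Data.Fin using (Fin; zero; suc)
import Data.Integer as ℤ
import Data.Integer.Properties as ℤ
open import Data.List
  using (List; []; _∷_; _++_; map; length; lookup; removeAt; insertAt; filterᵇ; foldr; applyDownFrom)
open import Data.List.Membership.Propositional using (_∈_)
open import Data.List.Membership.Propositional.Properties using (∈-∃++)
open import Data.List.Properties
  using (length-++; length-applyUpTo; ∷-injective; reverse-applyUpTo)
open import Data.List.Relation.Binary.Permutation.Propositional
  using (_↭_; prep; ↭⇒↭ₛ; ↭-sym; ↭-trans; ↭-refl; module PermutationReasoning)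
import Data.List.Relation.Binary.Permutation.Propositional.Properties as ↭
import Data.List.Relation.Binary.Permutation.Setoid.Properties as ↭ₛ
open import Data.List.Relation.Binary.Sublist.Propositional
  using (_⊆_; []; _∷_; _∷ʳ_; minimum; ⊆-refl)
import Data.List.Relation.Binary.Sublist.Propositional.Properties as Sublist
open import Data.List.Relation.Unary.All using (All; []; _∷_)
import Data.List.Relation.Unary.All as All
import Data.List.Relation.Unary.All.Properties as All
open import Data.List.Relation.Unary.AllPairs using (AllPairs; []; _∷_)
open import Data.List.Relation.Unary.Any using (here; there)
open import Data.List.Relation.Unary.Unique.Propositional using (Unique)
import Data.List.Relation.Unary.Unique.Propositional.Properties as Unique
open import Data.Maybe using (Maybe; just; nothing)
open import Data.Nat
  using (ℕ; zero; suc; _+_; _*_; _∸_; _⊔_; _≤_; _<_; z≤n; s≤s; _≡ᵇ_; _<ᵇ_; >-nonZero)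
open import Data.Nat.ListAction using (sum)
open import Data.Nat.ListAction.Properties using (sum-↭)
open import Data.Nat.Properties
open import Data.Nat.Tactic.RingSolver using (solve-∀)
open import Data.Product using (∃; ∃₂; _×_; _,_; proj₁; proj₂)
open import Data.Rational.Unnormalised using (_/_; *≤*)
open import Data.Sum using (inj₁; inj₂)
open import Data.Unit using (⊤; tt)
open import Data.Vec using (Vec; []; _∷_)
import Data.Vec as Vec
open import Function using (_∘_; case_of_)
open import Function.Bundles using (Equivalence)
open import Relation.Binary.PropositionalEquality
  using (_≡_; _≢_; refl; sym; trans; cong; cong₂; subst; subst₂; setoid; module ≡-Reasoning)
open import Relation.Nullary using (yes; no; contradiction)

-- Goodness depends on `y`, so the algorithm cannot see it; it sees only the vote. All guarantees
-- about the order it builds are therefore conditional on goodness, and an inconsistent triple is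
-- charged as a whole, without knowing which of its members is bad. The threshold of a quarter is
-- what protects two good symbols: fewer than half of `S` move either of them, and everybody else
-- votes as `y`.
--
-- Distances are defined by moves but counted through sets: a Boolean predicate of kept symbols on
-- which two permutations agree. Such sets intersect by `∧`, which turns `I ∪ I′` into a bound for a
-- pair, and their complements are measured by sums over the symbols, so that double counting is an
-- exchange of sums.
--
-- A bad symbol pays in two opposite ways: it spoils the voted order, but many pairs in `S` move it
-- together and thus come closer to each other than the triangle inequality through `y` predicts.
-- The weights 1 and 48 are those for which B cancels. `IsApproxMedian` compares with every
-- permutation, so the analysis is run for each `y`.

private
  variable
    A B : Set

≡ᵇ-refl : ∀ n → (n ≡ᵇ n) ≡ true
≡ᵇ-refl zero    = refl
≡ᵇ-refl (suc n) = ≡ᵇ-refl n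

≡ᵇ-true⇒≡ : ∀ m n → (m ≡ᵇ n) ≡ true → m ≡ n
≡ᵇ-true⇒≡ m n eq = ≡ᵇ⇒≡ m n (subst T (sym eq) _)

≢⇒≡ᵇ-false : ∀ m n → m ≢ n → (m ≡ᵇ n) ≡ false
≢⇒≡ᵇ-false m n m≢n with m ≡ᵇ n in eq
... | true  = contradiction (≡ᵇ-true⇒≡ m n eq) m≢n
... | false = refl

-- Compiling folds to WHILE

data Clock : Set where
  clockS clockD : Clock

infix  7 `_
infixr 6 _`∙_
infixr 0 `if_then_else_ ifᵗ_then_else_

-- Variables are de Bruijn indices; in the step of a fold, index 0 is the element and index 1 the
-- result so far. `call` gives a subroutine an environment of its own, so its correctness lemma
-- applies in any context.
data Tm : ℕ → Set where
  `_            : ∀ {k} → Fin k → Tm k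
  `nil          : ∀ {k} → Tm k
  _`∙_          : ∀ {k} → Tm k → Tm k → Tm k
  `hd `tl       : ∀ {k} → Tm k → Tm k
  `if_then_else_ : ∀ {k} → Tm k → Tm k → Tm k → Tm k
  `foldr        : ∀ {k} → Clock → (step : Tm (2 + k)) (base list : Tm k) → Tm k
  `call         : ∀ {k m} → Tm m → Vec (Tm k) m → Tm k

ifᵗ_then_else_ : Tree → Tree → Tree → Tree
ifᵗ nil     then t else u = u
ifᵗ (_ ∙ _) then t else u = t

spine : Tree → ℕ
spine nil     = 0
spine (_ ∙ r) = suc (spine r)

foldrᵗ : ℕ → (Tree → Tree → Tree) → Tree → Tree → Tree
foldrᵗ zero    f e l       = e
foldrᵗ (suc m) f e nil     = e
foldrᵗ (suc m) f e (x ∙ l) = f x (foldrᵗ m f e l)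

foldlᵗ : (Tree → Tree → Tree) → Tree → Tree → Tree
foldlᵗ f e nil     = e
foldlᵗ f e (x ∙ l) = foldlᵗ f (f x e) l

reverseOntoᵗ : ℕ → Tree → Tree → Tree
reverseOntoᵗ zero    l       s = s
reverseOntoᵗ (suc m) nil     s = s
reverseOntoᵗ (suc m) (x ∙ l) s = reverseOntoᵗ m l (x ∙ s)

-- A loop consumes a list from the front, so a right fold is run as a left fold over the reversed
-- list. Stopping the reversal after `m` elements keeps exactly those that `foldrᵗ m` looks at.
foldlᵗ-reverseOnto : ∀ f e m l s →
  foldlᵗ f e (reverseOntoᵗ m l s) ≡ foldlᵗ f (foldrᵗ m f e l) s
foldlᵗ-reverseOnto f e zero    l       s = refl
foldlᵗ-reverseOnto f e (suc m) nil     s = refl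
foldlᵗ-reverseOnto f e (suc m) (x ∙ l) s = foldlᵗ-reverseOnto f e m l (x ∙ s)

spine-reverseOnto : ∀ m l s → spine (reverseOntoᵗ m l s) ≤ m + spine s
spine-reverseOnto zero    l       s = ≤-refl
spine-reverseOnto (suc m) nil     s = m≤n+m (spine s) (suc m)
spine-reverseOnto (suc m) (x ∙ l) s =
  ≤-trans (spine-reverseOnto m l (x ∙ s)) (≤-reflexive (+-suc m (spine s)))

reverseOntoᵗ-nil : ∀ m s → reverseOntoᵗ m nil s ≡ s
reverseOntoᵗ-nil zero    s = refl
reverseOntoᵗ-nil (suc m) s = refl

module Evaluation (size : Clock → ℕ) where
  mutual
    eval : ∀ {k} → Tm k → Vec Tree k → Tree
    eval (` i)                    ρ = Vec.lookup ρ i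
    eval `nil                     ρ = nil
    eval (e `∙ f)                 ρ = eval e ρ ∙ eval f ρ
    eval (`hd e)                  ρ = left (eval e ρ)
    eval (`tl e)                  ρ = right (eval e ρ)
    eval (`if c then e else f)    ρ = ifᵗ eval c ρ then eval e ρ else eval f ρ
    eval (`foldr κ s b l)         ρ =
      foldrᵗ (size κ) (λ x r → eval s (x ∷ r ∷ ρ)) (eval b ρ) (eval l ρ)
    eval (`call f es)             ρ = eval f (evals es ρ)

    evals : ∀ {k m} → Vec (Tm k) m → Vec Tree k → Vec Tree m
    evals []       ρ = []
    evals (e ∷ es) ρ = eval e ρ ∷ evals es ρ

clockExpr : Clock → Expr
clockExpr clockS  = tl (var 0)
clockExpr clockD = hd (var 0)

varsFrom : ℕ → (m : ℕ) → Vec Var m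
varsFrom k zero    = []
varsFrom k (suc m) = k ∷ varsFrom (suc k) m

-- The loop lasts as long as the clock, even when the list is shorter; the test keeps an exhausted
-- list from contributing further elements.
reverseBody : ℕ → Cmd
reverseBody k =
  cond (var k)
    ((2 + k) ≔ cons (hd (var k)) (var (2 + k)) ⨾ k ≔ tl (var k))
    (k ≔ nil) ⨾
  (1 + k) ≔ tl (var (1 + k))

-- The environment sits in the variables vs, all of them below k; the result
-- goes to variable k and only variables from k on are overwritten.  Variable 0
-- keeps the input, whose two components serve as the clocks.
mutual
  compile : ∀ {m} → Vec Var m → ℕ → Tm m → Cmd
  compile vs k (` i)        = k ≔ var (Vec.lookup vs i)
  compile vs k `nil         = k ≔ nil
  compile vs k (e `∙ f)     =
    compile vs k e ⨾ compile vs (1 + k) f ⨾ k ≔ cons (var k) (var (1 + k))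
  compile vs k (`hd e)      = compile vs k e ⨾ k ≔ hd (var k)
  compile vs k (`tl e)      = compile vs k e ⨾ k ≔ tl (var k)
  compile vs k (`if c then e else f) =
    compile vs k c ⨾ cond (var k) (compile vs k e) (compile vs k f)
  compile vs k (`foldr κ s b l) =
    compile vs k l ⨾
    (1 + k) ≔ clockExpr κ ⨾
    (2 + k) ≔ nil ⨾
    while (var (1 + k)) (reverseBody k) ⨾
    compile vs (3 + k) b ⨾
    while (var (2 + k)) (foldBody vs k s) ⨾
    k ≔ var (3 + k)
  compile vs k (`call {m = m} f es) =
    compileAll vs k es ⨾ compile (varsFrom k m) (m + k) f ⨾ k ≔ var (m + k)

  foldBody : ∀ {m} → Vec Var m → ℕ → Tm (2 + m) → Cmd
  foldBody vs k s =
    k ≔ hd (var (2 + k)) ⨾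
    compile (k ∷ 3 + k ∷ vs) (4 + k) s ⨾
    (3 + k) ≔ var (4 + k) ⨾
    (2 + k) ≔ tl (var (2 + k))

  compileAll : ∀ {m l} → Vec Var m → ℕ → Vec (Tm m) l → Cmd
  compileAll vs k []       = k ≔ nil
  compileAll vs k (e ∷ es) = compile vs k e ⨾ compileAll vs (1 + k) es

clockPoly : Clock → Poly
clockPoly clockS  = 𝕟
clockPoly clockD = 𝕕

mutual
  bound : ∀ {k} → Tm k → Poly
  bound (` i)                 = const 2
  bound `nil                  = const 2
  bound (e `∙ f)              = bound e ⊕ (bound f ⊕ const 4)
  bound (`hd e)               = bound e ⊕ const 3
  bound (`tl e)               = bound e ⊕ const 3
  -- Polynomials have no maximum, so both branches are paid for.
  bound (`if c then e else f) = bound c ⊕ (const 2 ⊕ (bound e ⊕ bound f))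
  -- Each tick of the reversal costs 13 for the body and 2 for the test. Each element of the fold
  -- costs 2 for the test and 8 for fetching it, storing the result and advancing. The two
  -- assignments before the loops, the two final tests and the last copy make 11.
  bound (`foldr κ s b l)      =
    bound l ⊕ (const 11 ⊕ ((clockPoly κ ⊗ const 15) ⊕
    (bound b ⊕ (clockPoly κ ⊗ (bound s ⊕ const 10)))))
  bound (`call f es)          = bounds es ⊕ (bound f ⊕ const 2)

  bounds : ∀ {k m} → Vec (Tm k) m → Poly
  bounds []       = const 2
  bounds (e ∷ es) = bound e ⊕ bounds es

-- Correctness and running time of the compiler

update-same : ∀ (σ : Store) v t → (σ [ v ↦ t ]) v ≡ t
update-same σ v t rewrite ≡ᵇ-refl v = refl

update-other : ∀ (σ : Store) {v} t {w} → v ≢ w → (σ [ v ↦ t ]) w ≡ σ w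
update-other σ {v} t {w} v≢w rewrite ≢⇒≡ᵇ-false v w v≢w = refl

update-below : ∀ (σ : Store) {v} t {w} → w < v → (σ [ v ↦ t ]) w ≡ σ w
update-below σ t w<v = update-other σ t (λ v≡w → <-irrefl (sym v≡w) w<v)

update-above : ∀ (σ : Store) {v} t {w} → v < w → (σ [ v ↦ t ]) w ≡ σ w
update-above σ t v<w = update-other σ t (λ v≡w → <-irrefl v≡w v<w)

-- The frame condition of the compiler: pending intermediate results sit below the current register
-- and survive the evaluation of the next subterm.
SameBelow : ℕ → Store → Store → Set
SameBelow k σ τ = ∀ v → v < k → τ v ≡ σ v

sameBelow-trans : ∀ {k σ ρ τ} → SameBelow k σ ρ → SameBelow k ρ τ → SameBelow k σ τ
sameBelow-trans p q v v<k = trans (q v v<k) (p v v<k)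

sameBelow-weaken : ∀ {k l σ τ} → k ≤ l → SameBelow l σ τ → SameBelow k σ τ
sameBelow-weaken k≤l p v v<k = p v (<-≤-trans v<k k≤l)

sameBelow-update : ∀ (σ : Store) k t → SameBelow k σ (σ [ k ↦ t ])
sameBelow-update σ k t v v<k = update-below σ t v<k

-- A total-correctness triple with a time budget `b`.
Halts : Cmd → Store → ℕ → (Store → Set) → Set
Halts c σ b Q = ∃₂ λ t τ → (c , σ ⇓[ t ] τ) × t ≤ b × Q τ

halts-≔ : ∀ {v e σ Q} → Q (σ [ v ↦ ⟦ e ⟧ σ ]) → Halts (v ≔ e) σ (suc (time e)) Q
halts-≔ q = _ , _ , assign , ≤-refl , q

halts-⨾ : ∀ {c c′ σ b b′ Q R} →
  Halts c σ b Q → (∀ {ρ} → Q ρ → Halts c′ ρ b′ R) → Halts (c ⨾ c′) σ (b + b′) R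
halts-⨾ (t , ρ , run , t≤b , q) next with next q
... | t′ , τ , run′ , t′≤b′ , r = t + t′ , τ , comp run run′ , +-mono-≤ t≤b t′≤b′ , r

halts-weaken : ∀ {c σ b b′ Q} → b ≤ b′ → Halts c σ b Q → Halts c σ b′ Q
halts-weaken b≤b′ (t , τ , run , t≤b , q) = t , τ , run , ≤-trans t≤b b≤b′ , q

halts-map : ∀ {c σ b Q R} → Halts c σ b Q → (∀ {τ} → Q τ → R τ) → Halts c σ b R
halts-map (t , τ , run , t≤b , q) f = t , τ , run , t≤b , f q

-- Each round removes one element from the control variable, so the number of rounds is the length
-- of its spine. The invariant may mention what is left of it.
halts-while : ∀ {v c b} (Inv : Tree → Store → Set) →
  (∀ {l r σ} → σ v ≡ l ∙ r → Inv (l ∙ r) σ → Halts c σ b (λ τ → τ v ≡ r × Inv r τ)) →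
  ∀ w {σ} → σ v ≡ w → Inv w σ →
  Halts (while (var v) c) σ (spine w * (2 + b) + 2) (Inv nil)
halts-while Inv step nil eq inv = _ , _ , whileF eq , ≤-refl , inv
halts-while {b = b} Inv step (l ∙ r) eq inv with step eq inv
... | t , ρ , run , t≤b , eq′ , inv′ with halts-while Inv step r eq′ inv′
... | t′ , τ , run′ , t′≤ , q =
  _ , τ , whileT eq run run′ , bounded , q
  where
  bounded : 2 + t + t′ ≤ (2 + b) + spine r * (2 + b) + 2
  bounded = ≤-trans (+-mono-≤ (+-monoʳ-≤ 2 t≤b) t′≤)
                    (≤-reflexive (sym (+-assoc (2 + b) (spine r * (2 + b)) 2)))

program : Tm 1 → Cmd
program e = compile (0 ∷ []) 1 e ⨾ 0 ≔ var 1

module Compilation (input : Tree) where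

  size : Clock → ℕ
  size κ = spine (⟦ clockExpr κ ⟧ (initial input))

  open Evaluation size public

  n d : ℕ
  n = size clockS
  d = size clockD

  cost≤ : ∀ {k} → Tm k → ℕ
  cost≤ e = evalPoly (bound e) n d

  record Holds {m} (vs : Vec Var m) (k : ℕ) (σ : Store) (ρ : Vec Tree m) : Set where
    constructor holds
    field
      values : ∀ i → Vec.lookup vs i < k × σ (Vec.lookup vs i) ≡ Vec.lookup ρ i
      -- Variable 0 must never be overwritten: every fold reads its clock from it.
      0<k    : 0 < k
      in≡    : σ 0 ≡ input

  holds-mono : ∀ {m} {vs : Vec Var m} {k l σ τ ρ} → k ≤ l →
    SameBelow k σ τ → Holds vs k σ ρ → Holds vs l τ ρ
  holds-mono k≤l same (holds h 0<k in≡) =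
    holds (λ i → <-≤-trans (proj₁ (h i)) k≤l , trans (same _ (proj₁ (h i))) (proj₂ (h i)))
          (<-≤-trans 0<k k≤l) (trans (same 0 0<k) in≡)

  holds-∷ : ∀ {m} {vs : Vec Var m} {k σ ρ v t} → v < k → σ v ≡ t →
    Holds vs k σ ρ → Holds (v ∷ vs) k σ (t ∷ ρ)
  holds-∷ v<k eq (holds h 0<k in≡) =
    holds (λ { zero → v<k , eq ; (suc i) → h i }) 0<k in≡

  size-clockExpr : ∀ κ {σ} → σ 0 ≡ input → spine (⟦ clockExpr κ ⟧ σ) ≡ size κ
  size-clockExpr clockS  eq = cong (spine ∘ right) eq
  size-clockExpr clockD eq = cong (spine ∘ left) eq

  size-clockPoly : ∀ κ → evalPoly (clockPoly κ) n d ≡ size κ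
  size-clockPoly clockS  = refl
  size-clockPoly clockD = refl

  time-clockExpr : ∀ κ → time (clockExpr κ) ≡ 2
  time-clockExpr clockS  = refl
  time-clockExpr clockD = refl

  Yields : ℕ → Store → Tree → Store → Set
  Yields k σ t τ = τ k ≡ t × SameBelow k σ τ

  reverseBody-halts : ∀ k m {l r σ} → spine r ≡ m → σ (1 + k) ≡ l ∙ r →
    Halts (reverseBody k) σ 13
      (λ τ → τ (1 + k) ≡ r × SameBelow k σ τ ×
             reverseOntoᵗ m (τ k) (τ (2 + k)) ≡ reverseOntoᵗ (suc m) (σ k) (σ (2 + k)))
  reverseBody-halts k m {l} {r} {σ} refl eq with σ k in eqk
  ... | nil = halts-weaken (s≤s (s≤s (s≤s (s≤s (s≤s (s≤s (s≤s z≤n))))))) (halts-⨾ {b = 4} {Q = _≡ σ₁}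
      (_ , _ , condF eqk assign , ≤-refl , refl)
      λ { refl → halts-≔
        ( trans (update-same σ₁ (1 + k) _)
                (cong right (trans (update-above σ nil (n<1+n k)) eq))
        , (λ v v<k → trans (update-below σ₁ _ (m<n⇒m<1+n v<k)) (update-below σ nil v<k))
        , trans (cong₂ (reverseOntoᵗ m)
                   (trans (update-below σ₁ _ (n<1+n k)) (update-same σ k nil))
                   (trans (update-above σ₁ _ (n<1+n (1 + k)))
                          (update-above σ nil (m<n⇒m<1+n (n<1+n k)))))
                (reverseOntoᵗ-nil m (σ (2 + k)))) })
    where
    σ₁ = σ [ k ↦ nil ]
  ... | x ∙ y = halts-⨾ {b = 10} {b′ = 3} {Q = _≡ σ₂}
      (_ , _ , condT eqk (comp assign assign) , ≤-refl , refl)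
      λ { refl → halts-≔
        ( trans (update-same σ₂ (1 + k) _)
                (cong right (trans (update-above σ₁ _ (n<1+n k))
                                   (trans (update-below σ _ (n<1+n (1 + k))) eq)))
        , (λ v v<k → trans (update-below σ₂ _ (m<n⇒m<1+n v<k))
                    (trans (update-below σ₁ _ v<k)
                           (update-below σ _ (m<n⇒m<1+n (m<n⇒m<1+n v<k)))))
        , cong₂ (reverseOntoᵗ m)
            (trans (update-below σ₂ _ (n<1+n k))
            (trans (update-same σ₁ k _)
                   (cong right (trans (update-below σ _ (m<n⇒m<1+n (n<1+n k))) eqk))))
            (trans (update-above σ₂ _ (n<1+n (1 + k)))
            (trans (update-above σ₁ _ (m<n⇒m<1+n (n<1+n k)))
            (trans (update-same σ (2 + k) _)
                   (cong (λ s → left s ∙ σ (2 + k)) eqk))))) }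
    where
    σ₁ = σ [ 2 + k ↦ left (σ k) ∙ σ (2 + k) ]
    σ₂ = σ₁ [ k ↦ right (σ₁ k) ]

  mutual
    compile-correct : ∀ {m} (e : Tm m) {vs k σ ρ} → Holds vs k σ ρ →
      Halts (compile vs k e) σ (cost≤ e) (Yields k σ (eval e ρ))
    compile-correct (` i) {k = k} {σ = σ} (holds h _ _) =
      halts-≔ (trans (update-same σ k _) (proj₂ (h i)) , sameBelow-update σ k _)
    compile-correct `nil {k = k} {σ = σ} h =
      halts-≔ (update-same σ k nil , sameBelow-update σ k nil)
    compile-correct (e `∙ f) {k = k} {σ = σ} h =
      halts-⨾ (compile-correct e h) λ (eq₁ , same₁) →
      halts-⨾ (compile-correct f (holds-mono (n≤1+n k) same₁ h)) λ {ρ} (eq₂ , same₂) →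
      halts-≔ ( trans (update-same ρ k _)
                      (cong₂ _∙_ (trans (same₂ k (n<1+n k)) eq₁) eq₂)
              , sameBelow-trans same₁ (sameBelow-trans (sameBelow-weaken (n≤1+n k) same₂)
                                                       (sameBelow-update ρ k _)))
    compile-correct (`hd e) {k = k} h =
      halts-⨾ (compile-correct e h) λ {ρ} (eq , same) →
      halts-≔ ( trans (update-same ρ k _) (cong left eq)
              , sameBelow-trans same (sameBelow-update ρ k _))
    compile-correct (`tl e) {k = k} h =
      halts-⨾ (compile-correct e h) λ {ρ} (eq , same) →
      halts-≔ ( trans (update-same ρ k _) (cong right eq)
              , sameBelow-trans same (sameBelow-update ρ k _))
    compile-correct (`if c then e else f) {vs = vs} {k = k} {σ = σ} {ρ = ρ} h =
      halts-⨾ (compile-correct c h) branch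
      where
      branch : ∀ {τ} → Yields k σ (eval c ρ) τ →
        Halts (cond (var k) (compile vs k e) (compile vs k f)) τ
          (2 + (cost≤ e + cost≤ f))
          (Yields k σ (ifᵗ eval c ρ then eval e ρ else eval f ρ))
      branch (eq , same) with eval c ρ
      ... | nil with compile-correct f (holds-mono ≤-refl same h)
      ...   | t , τ′ , run , t≤ , eq′ , same′ =
              _ , τ′ , condF eq run , +-monoʳ-≤ 2 (≤-trans t≤ (m≤n+m _ _)) ,
              eq′ , sameBelow-trans same same′
      branch (eq , same) | _ ∙ _ with compile-correct e (holds-mono ≤-refl same h)
      ...   | t , τ′ , run , t≤ , eq′ , same′ =
              _ , τ′ , condT eq run , +-monoʳ-≤ 2 (≤-trans t≤ (m≤m+n _ _)) ,
              eq′ , sameBelow-trans same same′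
    compile-correct (`foldr κ s b l) {vs = vs} {k = k} {σ = σ} {ρ = ρ} h@(holds _ 0<k in≡) =
      halts-weaken time≤
      (halts-⨾ (compile-correct l h) λ {σ₁} (eq₁ , same₁) →
       halts-⨾ {b = 3} {Q = λ τ → spine (τ (1 + k)) ≡ size κ × τ k ≡ eval l ρ × SameBelow k σ τ}
         (halts-weaken (≤-reflexive (cong suc (time-clockExpr κ))) (halts-≔
           ( trans (cong spine (update-same σ₁ (1 + k) _))
                   (size-clockExpr κ (trans (same₁ 0 0<k) in≡))
           , trans (update-below σ₁ _ (k<+ 0)) eq₁
           , sameBelow-trans same₁
               (sameBelow-weaken (n≤1+n k) (sameBelow-update σ₁ (1 + k) _)))))
         λ {σ₂} (eq₂ , list₂ , same₂) →
       halts-⨾ {Q = Reversing (size κ)}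
         (halts-≔
           ( trans (cong spine (update-below σ₂ nil (n<1+n (1 + k)))) eq₂
           , sameBelow-trans same₂
               (sameBelow-weaken (m≤n+m k 2) (sameBelow-update σ₂ (2 + k) nil))
           , cong₂ (reverseOntoᵗ (size κ))
               (trans (update-below σ₂ nil (k<+ 1)) list₂)
               (update-same σ₂ (2 + k) nil)))
         λ {σ₃} rev₃ →
       halts-⨾ (reverse-halts rev₃) λ {σ₄} (_ , same₄ , rev₄) →
       halts-⨾ (compile-correct b (holds-mono (m≤n+m k 3) same₄ h)) λ {σ₅} (eq₅ , same₅) →
       halts-⨾ (fold-halts (trans (same₅ (2 + k) (n<1+n (2 + k))) rev₄)
                 ( trans (cong (λ t → foldlᵗ step t reversed) eq₅)
                         (foldlᵗ-reverseOnto step _ (size κ) (eval l ρ) nil)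
                 , sameBelow-trans same₄ (sameBelow-weaken (m≤n+m k 3) same₅)))
         λ {σ₆} (eq₆ , same₆) →
       halts-≔ ( trans (update-same σ₆ k _) eq₆
               , sameBelow-trans same₆ (sameBelow-update σ₆ k _)))
      where
      k<+ : ∀ i → k < suc i + k
      k<+ i = s≤s (m≤n+m k i)

      step : Tree → Tree → Tree
      step x r = eval s (x ∷ r ∷ ρ)

      reversed : Tree
      reversed = reverseOntoᵗ (size κ) (eval l ρ) nil

      -- Loop invariant: reversing what is left onto what has been collected always gives the same
      -- final list.
      Reversing : ℕ → Store → Set
      Reversing m τ =
        spine (τ (1 + k)) ≡ m × SameBelow k σ τ × reverseOntoᵗ m (τ k) (τ (2 + k)) ≡ reversed

      reverseStep : ∀ {x y τ} → τ (1 + k) ≡ x ∙ y → Reversing (suc (spine y)) τ →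
        Halts (reverseBody k) τ 13 (λ τ′ → τ′ (1 + k) ≡ y × Reversing (spine y) τ′)
      reverseStep {y = y} eq (_ , same , rev) with reverseBody-halts k (spine y) refl eq
      ... | t , τ′ , run , t≤ , eq′ , same′ , rev′ =
        t , τ′ , run , t≤ , eq′ , cong spine eq′ , sameBelow-trans same same′ , trans rev′ rev

      reverse-halts : ∀ {τ} → Reversing (size κ) τ →
        Halts (while (var (1 + k)) (reverseBody k)) τ (size κ * 15 + 2) (Reversing 0)
      reverse-halts {τ} inv@(eq , _) =
        subst (λ c → Halts _ τ (c * 15 + 2) (Reversing 0)) eq
          (halts-while (λ w → Reversing (spine w)) reverseStep (τ (1 + k)) refl
            (subst (λ c → Reversing c τ) (sym eq) inv))

      -- Loop invariant: folding the remaining list from the current accumulator always gives the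
      -- value of the entire fold.
      Folding : Tree → Store → Set
      Folding w τ =
        foldlᵗ step (τ (3 + k)) w ≡ eval (`foldr κ s b l) ρ × SameBelow k σ τ

      foldStep : ∀ {x y τ} → τ (2 + k) ≡ x ∙ y → Folding (x ∙ y) τ →
        Halts (foldBody vs k s) τ (3 + (cost≤ s + 5)) (λ τ′ → τ′ (2 + k) ≡ y × Folding y τ′)
      foldStep {x} {y} {τ} eq (acc , same) =
        halts-⨾ {Q = λ τ₁ → τ₁ k ≡ x × τ₁ (3 + k) ≡ τ (3 + k) × τ₁ (2 + k) ≡ x ∙ y × SameBelow k σ τ₁}
          (halts-≔ ( trans (update-same τ k _) (cong left eq)
                   , update-above τ _ (k<+ 2)
                   , trans (update-above τ _ (k<+ 1)) eq
                   , sameBelow-trans same (sameBelow-update τ k _)))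
          λ {τ₁} (elem₁ , acc₁ , list₁ , same₁) →
        halts-⨾ (compile-correct s
                  (holds-∷ (k<+ 3) elem₁
                  (holds-∷ (n<1+n (3 + k)) acc₁
                  (holds-mono (m≤n+m k 4) same₁ h))))
          λ {τ₂} (eq₂ , same₂) →
        halts-⨾ {Q = λ τ₃ → τ₃ (3 + k) ≡ step x (τ (3 + k)) × τ₃ (2 + k) ≡ x ∙ y × SameBelow k σ τ₃}
          (halts-≔ ( trans (update-same τ₂ (3 + k) _) eq₂
                   , trans (update-below τ₂ _ (n<1+n (2 + k)))
                           (trans (same₂ (2 + k) (s≤s (n≤1+n (2 + k)))) list₁)
                   , sameBelow-trans same₁
                       (sameBelow-weaken (m≤n+m k 3)
                         (sameBelow-trans (sameBelow-weaken (n≤1+n (3 + k)) same₂)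
                                          (sameBelow-update τ₂ (3 + k) _)))))
          λ {τ₃} (acc₃ , list₃ , same₃) →
        halts-≔ ( trans (update-same τ₃ (2 + k) _) (cong right list₃)
                , trans (cong (λ t → foldlᵗ step t y)
                          (trans (update-above τ₃ _ (n<1+n (2 + k))) acc₃)) acc
                , sameBelow-trans same₃
                    (sameBelow-weaken (m≤n+m k 2) (sameBelow-update τ₃ (2 + k) _)))

      fold-halts : ∀ {τ} → τ (2 + k) ≡ reversed → Folding reversed τ →
        Halts (while (var (2 + k)) (foldBody vs k s)) τ
              (size κ * (2 + (3 + (cost≤ s + 5))) + 2) (Folding nil)
      fold-halts eq inv =
        halts-weaken (+-monoˡ-≤ 2 (*-monoˡ-≤ _
          (≤-trans (spine-reverseOnto (size κ) (eval l ρ) nil)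
                   (≤-reflexive (+-identityʳ (size κ))))))
          (halts-while Folding foldStep reversed eq inv)

      rearrange : ∀ L N B S →
        L + (3 + (2 + ((N * 15 + 2) + (B + ((N * (2 + (3 + (S + 5))) + 2) + 2))))) ≡
        L + (11 + (N * 15 + (B + N * (S + 10))))
      rearrange = solve-∀

      time≤ : cost≤ l + (3 + (2 + ((size κ * 15 + 2) +
                (cost≤ b + ((size κ * (2 + (3 + (cost≤ s + 5))) + 2) + 2)))))
              ≤ cost≤ (`foldr κ s b l)
      time≤ rewrite size-clockPoly κ =
        ≤-reflexive (rearrange (cost≤ l) (size κ) (cost≤ b) (cost≤ s))
    compile-correct (`call {m = m} f es) {k = k} {σ = σ} h =
      halts-⨾ (compileAll-correct es h) λ {σ₁} (args , same₁) →
      halts-⨾ (compile-correct f args) λ {σ₂} (eq , same₂) →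
      halts-≔ ( trans (update-same σ₂ k _) eq
              , sameBelow-trans same₁
                  (sameBelow-trans (sameBelow-weaken (m≤n+m k m) same₂)
                                   (sameBelow-update σ₂ k _)))

    compileAll-correct : ∀ {m l} (es : Vec (Tm m) l) {vs k σ ρ} → Holds vs k σ ρ →
      Halts (compileAll vs k es) σ (evalPoly (bounds es) n d)
        (λ τ → Holds (varsFrom k l) (l + k) τ (evals es ρ) × SameBelow k σ τ)
    compileAll-correct [] {k = k} {σ = σ} (holds _ 0<k in≡) =
      halts-≔ (holds (λ ()) 0<k (trans (update-below σ nil 0<k) in≡) , sameBelow-update σ k nil)
    compileAll-correct {l = suc l} (e ∷ es) {k = k} {ρ = ρ} h =
      halts-⨾ (compile-correct e h) λ {σ₁} (eq₁ , same₁) →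
      halts-map (compileAll-correct es (holds-mono (n≤1+n k) same₁ h))
        λ {σ₂} (args , same₂) →
          holds-∷ (s≤s (m≤n+m k l)) (trans (same₂ k (n<1+n k)) eq₁)
            (subst (λ j → Holds (varsFrom (1 + k) l) j σ₂ (evals es ρ)) (+-suc l k) args) ,
          sameBelow-trans same₁ (sameBelow-weaken (n≤1+n k) same₂)

  program-computes : ∀ e →
    Computes (program e) input (eval e (input ∷ [])) (evalPoly (bound e ⊕ const 2) n d)
  program-computes e
    with halts-⨾ {R = λ τ → τ 0 ≡ eval e (input ∷ [])}
           (compile-correct e (holds {σ = initial input} (λ { zero → s≤s z≤n , refl }) (s≤s z≤n) refl))
           (λ {ρ} (eq , _) → halts-≔ {v = 0} {e = var 1} {σ = ρ} eq)
  ... | t , τ , run , t≤ , eq = t , τ , run , eq , t≤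

-- Sums and filters

∑ : (A → ℕ) → List A → ℕ
∑ f xs = sum (map f xs)

bit : Bool → ℕ
bit true  = 1
bit false = 0

∑-mono : ∀ {f g : A → ℕ} → (∀ x → f x ≤ g x) → ∀ xs → ∑ f xs ≤ ∑ g xs
∑-mono f≤g []       = z≤n
∑-mono f≤g (x ∷ xs) = +-mono-≤ (f≤g x) (∑-mono f≤g xs)

∑-cong : ∀ {f g : A → ℕ} → (∀ x → f x ≡ g x) → ∀ xs → ∑ f xs ≡ ∑ g xs
∑-cong f≡g []       = refl
∑-cong f≡g (x ∷ xs) = cong₂ _+_ (f≡g x) (∑-cong f≡g xs)

∑-distrib-+ : ∀ (f g : A → ℕ) xs → ∑ (λ x → f x + g x) xs ≡ ∑ f xs + ∑ g xs
∑-distrib-+ f g []       = refl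
∑-distrib-+ f g (x ∷ xs) =
  trans (cong (f x + g x +_) (∑-distrib-+ f g xs)) (interchange (f x) (g x) (∑ f xs) (∑ g xs))
  where
  interchange : ∀ a b c d → (a + b) + (c + d) ≡ (a + c) + (b + d)
  interchange = solve-∀

∑-distribˡ-* : ∀ c (f : A → ℕ) xs → ∑ (λ x → c * f x) xs ≡ c * ∑ f xs
∑-distribˡ-* c f []       = sym (*-zeroʳ c)
∑-distribˡ-* c f (x ∷ xs) =
  trans (cong (c * f x +_) (∑-distribˡ-* c f xs)) (sym (*-distribˡ-+ c (f x) (∑ f xs)))

∑-const : ∀ c (xs : List A) → ∑ (λ _ → c) xs ≡ length xs * c
∑-const c []       = refl
∑-const c (x ∷ xs) = cong (c +_) (∑-const c xs)

∑-swap : ∀ (f : A → B → ℕ) xs ys →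
  ∑ (λ x → ∑ (f x) ys) xs ≡ ∑ (λ y → ∑ (λ x → f x y) xs) ys
∑-swap f []       ys = sym (trans (∑-const 0 ys) (*-zeroʳ (length ys)))
∑-swap f (x ∷ xs) ys =
  trans (cong (∑ (f x) ys +_) (∑-swap f xs ys))
        (sym (∑-distrib-+ (f x) (λ y → ∑ (λ z → f z y) xs) ys))

∑-++ : ∀ (f : A → ℕ) xs ys → ∑ f (xs ++ ys) ≡ ∑ f xs + ∑ f ys
∑-++ f []       ys = refl
∑-++ f (x ∷ xs) ys = trans (cong (f x +_) (∑-++ f xs ys)) (sym (+-assoc (f x) _ _))

∑-↭ : ∀ (f : A → ℕ) {xs ys} → xs ↭ ys → ∑ f xs ≡ ∑ f ys
∑-↭ f xs↭ys = sum-↭ (↭.map⁺ f xs↭ys)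

-- The indicator of the complement of `K`. As a number it makes the size of a set a sum, which can
-- be exchanged with sums over `S`.
dropped : (A → Bool) → A → ℕ
dropped K a = bit (not (K a))

filterᵇ-accept : ∀ (K : A → Bool) {a} xs → K a ≡ true → filterᵇ K (a ∷ xs) ≡ a ∷ filterᵇ K xs
filterᵇ-accept K xs eq rewrite eq = refl

filterᵇ-reject : ∀ (K : A → Bool) {a} xs → K a ≡ false → filterᵇ K (a ∷ xs) ≡ filterᵇ K xs
filterᵇ-reject K xs eq rewrite eq = refl

filterᵇ-reject-mid : ∀ (K : A → Bool) {a} xs ys → K a ≡ false →
  filterᵇ K (xs ++ a ∷ ys) ≡ filterᵇ K (xs ++ ys)
filterᵇ-reject-mid K []       ys eq = filterᵇ-reject K ys eq
filterᵇ-reject-mid K (x ∷ xs) ys eq with K x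
... | true  = cong (x ∷_) (filterᵇ-reject-mid K xs ys eq)
... | false = filterᵇ-reject-mid K xs ys eq

filterᵇ-∧ : ∀ (K K′ : A → Bool) xs →
  filterᵇ (λ a → K a ∧ K′ a) xs ≡ filterᵇ K (filterᵇ K′ xs)
filterᵇ-∧ K K′ []       = refl
filterᵇ-∧ K K′ (x ∷ xs) with K′ x
filterᵇ-∧ K K′ (x ∷ xs) | true with K x
... | true  = cong (x ∷_) (filterᵇ-∧ K K′ xs)
... | false = filterᵇ-∧ K K′ xs
filterᵇ-∧ K K′ (x ∷ xs) | false with K x
... | true  = filterᵇ-∧ K K′ xs
... | false = filterᵇ-∧ K K′ xs

filterᵇ-comm : ∀ (K K′ : A → Bool) xs → filterᵇ K (filterᵇ K′ xs) ≡ filterᵇ K′ (filterᵇ K xs)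
filterᵇ-comm K K′ xs = trans (sym (filterᵇ-∧ K K′ xs)) (trans (cong-∧ xs) (filterᵇ-∧ K′ K xs))
  where
  cong-∧ : ∀ xs → filterᵇ (λ a → K a ∧ K′ a) xs ≡ filterᵇ (λ a → K′ a ∧ K a) xs
  cong-∧ []       = refl
  cong-∧ (x ∷ xs) with K x | K′ x
  ... | true  | true  = cong (x ∷_) (cong-∧ xs)
  ... | true  | false = cong-∧ xs
  ... | false | true  = cong-∧ xs
  ... | false | false = cong-∧ xs

length-filterᵇ : ∀ (K : A → Bool) xs → length (filterᵇ K xs) + ∑ (dropped K) xs ≡ length xs
length-filterᵇ K []       = refl
length-filterᵇ K (x ∷ xs) with K x
... | true  = cong suc (length-filterᵇ K xs)
... | false = trans (+-suc _ _) (cong suc (length-filterᵇ K xs))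

-- Character moves and common subsequences

insertAt-middle : ∀ (a : A) xs ys → ∃ λ j → insertAt (xs ++ ys) j a ≡ xs ++ a ∷ ys
insertAt-middle a []       ys = zero , refl
insertAt-middle a (x ∷ xs) ys with insertAt-middle a xs ys
... | j , eq = suc j , cong (x ∷_) eq

removeAt-middle : ∀ (a : A) xs ys →
  ∃ λ i → removeAt (xs ++ a ∷ ys) i ≡ xs ++ ys × lookup (xs ++ a ∷ ys) i ≡ a
removeAt-middle a []       ys = zero , refl , refl
removeAt-middle a (x ∷ xs) ys with removeAt-middle a xs ys
... | i , eq , eq′ = suc i , cong (x ∷_) eq , eq′

move-from-front : ∀ a xs ys → Moves 1 (a ∷ xs ++ ys) (xs ++ a ∷ ys)
move-from-front a xs ys = zero , insertAt-middle a xs ys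

move-to-front : ∀ a xs ys → Moves 1 (xs ++ a ∷ ys) (a ∷ xs ++ ys)
move-to-front a xs ys with removeAt-middle a xs ys
... | i , eq , eq′ = i , zero , cong₂ _∷_ eq′ eq

-- A dropped symbol at the head of y is first moved to the head of x; one at
-- the head of x travels along as the head and is moved to its place last.
aligned⇒moves : ∀ (K : ℕ → Bool) l {x y} → length x ≤ l → x ↭ y →
  filterᵇ K x ≡ filterᵇ K y → Moves (∑ (dropped K) x) x y
aligned⇒moves K l {[]} {y} _ x↭y _ with ↭.↭-empty-inv (↭-sym x↭y)
... | refl = refl
aligned⇒moves K (suc l) {a ∷ x} {y} (s≤s x≤l) x↭y eq with K a in Ka
aligned⇒moves K (suc l) {a ∷ x} {y} (s≤s x≤l) x↭y eq | false
  with ∈-∃++ (↭.∈-resp-↭ x↭y (here refl))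
... | y₁ , y₂ , refl =
  subst (λ k → Moves k (a ∷ x) (y₁ ++ a ∷ y₂)) (+-comm (∑ (dropped K) x) 1)
    (moves-trans (∑ (dropped K) x)
      (moves-cons (∑ (dropped K) x) a
        (aligned⇒moves K l x≤l (↭.drop-mid [] y₁ x↭y)
          (trans eq (filterᵇ-reject-mid K y₁ y₂ Ka))))
      (move-from-front a y₁ y₂))
aligned⇒moves K (suc l) {a ∷ x} {[]}    _         x↭y eq | true with ↭.↭-empty-inv x↭y
... | ()
aligned⇒moves K (suc l) {a ∷ x} {b ∷ y} (s≤s x≤l) x↭y eq | true with K b in Kb
... | true with ∷-injective eq
...   | refl , eq′ =
  moves-cons (∑ (dropped K) x) a (aligned⇒moves K l x≤l (↭.drop-∷ x↭y) eq′)
aligned⇒moves K (suc l) {a ∷ x} {b ∷ y} (s≤s x≤l) x↭y eq | true | false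
  with ∈-∃++ (↭.∈-resp-↭ (↭-sym x↭y) (here refl))
... | [] , x₂ , refl with trans (sym Ka) Kb
...   | ()
aligned⇒moves K (suc l) {a ∷ x} {b ∷ y} (s≤s x≤l) x↭y eq | true | false
    | a ∷ x₁ , x₂ , refl =
  subst (λ k → Moves k (a ∷ x₁ ++ b ∷ x₂) (b ∷ y)) count
    (moves-trans 1 (move-to-front b (a ∷ x₁) x₂)
      (moves-cons (∑ (dropped K) (a ∷ x₁ ++ x₂)) b
        (aligned⇒moves K l shorter (↭.drop-mid (a ∷ x₁) [] x↭y) aligned)))
  where
  -- The recursive call is on a list that is not a subterm of the argument; the length bound `l` is
  -- what decreases.
  shorter : length (a ∷ x₁ ++ x₂) ≤ l
  shorter = ≤-trans (≤-reflexive (sym (↭.↭-length (↭.shift b x₁ x₂)))) x≤l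

  aligned : filterᵇ K (a ∷ x₁ ++ x₂) ≡ filterᵇ K y
  aligned rewrite Ka = trans (cong (a ∷_) (sym (filterᵇ-reject-mid K x₁ x₂ Kb))) eq

  count : suc (∑ (dropped K) (a ∷ x₁ ++ x₂)) ≡ ∑ (dropped K) (x₁ ++ b ∷ x₂)
  count rewrite Ka | ∑-↭ (dropped K) (↭.shift b x₁ x₂) | Kb = refl

filterᵇ-removeAt : ∀ (K : A → Bool) xs i → K (lookup xs i) ≡ false →
  filterᵇ K (removeAt xs i) ≡ filterᵇ K xs
filterᵇ-removeAt K (x ∷ xs) zero    eq = sym (filterᵇ-reject K xs eq)
filterᵇ-removeAt K (x ∷ xs) (suc i) eq with K x
... | true  = cong (x ∷_) (filterᵇ-removeAt K xs i eq)
... | false = filterᵇ-removeAt K xs i eq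

filterᵇ-insertAt : ∀ (K : A → Bool) xs j {a} → K a ≡ false →
  filterᵇ K (insertAt xs j a) ≡ filterᵇ K xs
filterᵇ-insertAt K xs       zero    eq = filterᵇ-reject K xs eq
filterᵇ-insertAt K (x ∷ xs) (suc j) eq with K x
... | true  = cong (x ∷_) (filterᵇ-insertAt K xs j eq)
... | false = filterᵇ-insertAt K xs j eq

infix 5 _∉ᵇ_

_∉ᵇ_ : ℕ → List ℕ → Bool
a ∉ᵇ []       = true
a ∉ᵇ (m ∷ ms) = not (a ≡ᵇ m) ∧ (a ∉ᵇ ms)

-- A move leaves the relative order of the other symbols intact, so erasing every symbol that is
-- ever moved makes both ends equal. `ms` records one symbol per move, possibly with repetitions,
-- whence its exact length.
moves⇒aligned : ∀ k {x y} → Moves k x y →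
  ∃ λ ms → length ms ≡ k × filterᵇ (_∉ᵇ ms) x ≡ filterᵇ (_∉ᵇ ms) y
moves⇒aligned zero    refl = [] , refl , refl
moves⇒aligned (suc k) {x} {y} (i , j , p) with moves⇒aligned k p
... | ms , len , eq = m ∷ ms , cong suc len ,
  (begin
    filterᵇ (_∉ᵇ (m ∷ ms)) x                       ≡⟨ moved ⟨
    filterᵇ (_∉ᵇ (m ∷ ms)) (move x i j)            ≡⟨ filterᵇ-∧ _ _ (move x i j) ⟩
    filterᵇ (not ∘ (_≡ᵇ m)) (filterᵇ (_∉ᵇ ms) (move x i j)) ≡⟨ cong (filterᵇ _) eq ⟩
    filterᵇ (not ∘ (_≡ᵇ m)) (filterᵇ (_∉ᵇ ms) y)   ≡⟨ filterᵇ-∧ _ _ y ⟨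
    filterᵇ (_∉ᵇ (m ∷ ms)) y                       ∎)
  where
  open ≡-Reasoning
  m = lookup x i

  rejected : (m ∉ᵇ (m ∷ ms)) ≡ false
  rejected rewrite ≡ᵇ-refl m = refl

  moved : filterᵇ (_∉ᵇ (m ∷ ms)) (move x i j) ≡ filterᵇ (_∉ᵇ (m ∷ ms)) x
  moved = trans (filterᵇ-insertAt (_∉ᵇ (m ∷ ms)) (removeAt x i) j rejected)
                (filterᵇ-removeAt (_∉ᵇ (m ∷ ms)) x i rejected)

∑-≡ᵇ-absent : ∀ m {xs} → All (m ≢_) xs → ∑ (λ a → bit (a ≡ᵇ m)) xs ≡ 0
∑-≡ᵇ-absent m []           = refl
∑-≡ᵇ-absent m {x ∷ _} (m≢x ∷ m∉xs)
  rewrite ≢⇒≡ᵇ-false x m (m≢x ∘ sym) = ∑-≡ᵇ-absent m m∉xs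

∑-≡ᵇ-unique : ∀ m {xs} → Unique xs → ∑ (λ a → bit (a ≡ᵇ m)) xs ≤ 1
∑-≡ᵇ-unique m [] = z≤n
∑-≡ᵇ-unique m {x ∷ _} (x∉xs ∷ u) with x ≡ᵇ m in eq
... | false = ∑-≡ᵇ-unique m u
... | true rewrite ≡ᵇ-true⇒≡ x m eq | ∑-≡ᵇ-absent m x∉xs = ≤-refl

-- A union bound: in a list without repetitions each entry of `ms` accounts for at most one dropped
-- symbol.
∑-dropped-∉ᵇ : ∀ ms {xs} → Unique xs → ∑ (dropped (_∉ᵇ ms)) xs ≤ length ms
∑-dropped-∉ᵇ []       {xs} u = ≤-reflexive (trans (∑-const 0 xs) (*-zeroʳ (length xs)))
∑-dropped-∉ᵇ (m ∷ ms) {xs} u = begin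
  ∑ (dropped (_∉ᵇ (m ∷ ms))) xs
    ≤⟨ ∑-mono (λ a → or≤+ (a ≡ᵇ m) (a ∉ᵇ ms)) xs ⟩
  ∑ (λ a → bit (a ≡ᵇ m) + dropped (_∉ᵇ ms) a) xs
    ≡⟨ ∑-distrib-+ (λ a → bit (a ≡ᵇ m)) (dropped (_∉ᵇ ms)) xs ⟩
  ∑ (λ a → bit (a ≡ᵇ m)) xs + ∑ (dropped (_∉ᵇ ms)) xs
    ≤⟨ +-mono-≤ (∑-≡ᵇ-unique m u) (∑-dropped-∉ᵇ ms u) ⟩
  suc (length ms) ∎
  where
  open ≤-Reasoning
  or≤+ : ∀ p q → bit (not (not p ∧ q)) ≤ bit p + bit (not q)
  or≤+ true  q = s≤s z≤n
  or≤+ false q = ≤-refl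

-- The Ulam distance of permutations

unique-[1‥] : ∀ d → Unique [1‥ d ]
unique-[1‥] d = Unique.applyUpTo⁺₁ suc d λ i<j _ eq → <⇒≢ i<j (suc-injective eq)

unique-resp-↭ : ∀ {xs ys : List ℕ} → xs ↭ ys → Unique xs → Unique ys
unique-resp-↭ xs↭ys = ↭ₛ.Unique-resp-↭ (setoid ℕ) (↭⇒↭ₛ xs↭ys)

module _ {d : ℕ} where

  unique-seq : ∀ (x : Perm d) → Unique (seq x)
  unique-seq x = unique-resp-↭ (↭-sym (isPerm x)) (unique-[1‥] d)

  length-seq : ∀ (x : Perm d) → length (seq x) ≡ d
  length-seq x = trans (↭.↭-length (isPerm x)) (length-applyUpTo suc d)

  seq-↭ : ∀ (x y : Perm d) → seq x ↭ seq y
  seq-↭ x y = ↭-trans (isPerm x) (↭-sym (isPerm y))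

  Δ-moves : ∀ (x y : Perm d) → Moves (Δ x y) (seq x) (seq y)
  Δ-moves x y = proj₁ (proj₂ (minMoves x y))

  Δ-minimal : ∀ (x y : Perm d) k → Moves k (seq x) (seq y) → Δ x y ≤ k
  Δ-minimal x y = proj₂ (proj₂ (minMoves x y))

  Δ-triangle : ∀ (x y z : Perm d) → Δ x z ≤ Δ x y + Δ y z
  Δ-triangle x y z = Δ-minimal x z _ (moves-trans (Δ x y) (Δ-moves x y) (Δ-moves y z))

  Δ-upper : ∀ (x y : Perm d) K → filterᵇ K (seq x) ≡ filterᵇ K (seq y) →
    Δ x y ≤ ∑ (dropped K) [1‥ d ]
  Δ-upper x y K eq = ≤-trans
    (Δ-minimal x y _ (aligned⇒moves K (length (seq x)) ≤-refl (seq-↭ x y) eq))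
    (≤-reflexive (∑-↭ (dropped K) (isPerm x)))

  -- The sequence of moves is the optimal one that comes with `Δ x y`; it is fixed here once for
  -- each pair.
  unmoved : Perm d → Perm d → ℕ → Bool
  unmoved x y a = a ∉ᵇ proj₁ (moves⇒aligned (Δ x y) (Δ-moves x y))

  unmoved-aligned : ∀ x y → filterᵇ (unmoved x y) (seq x) ≡ filterᵇ (unmoved x y) (seq y)
  unmoved-aligned x y = proj₂ (proj₂ (moves⇒aligned (Δ x y) (Δ-moves x y)))

  ∑-moved≤Δ : ∀ x y → ∑ (dropped (unmoved x y)) [1‥ d ] ≤ Δ x y
  ∑-moved≤Δ x y with moves⇒aligned (Δ x y) (Δ-moves x y)
  ... | ms , len , _ = ≤-trans (∑-dropped-∉ᵇ ms (unique-[1‥] d)) (≤-reflexive len)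

infix 5 _∈ᵇ_

_∈ᵇ_ : ℕ → List ℕ → Bool
a ∈ᵇ zs = any (a ≡ᵇ_) zs

∈ᵇ-absent : ∀ {a zs} → All (a ≢_) zs → (a ∈ᵇ zs) ≡ false
∈ᵇ-absent [] = refl
∈ᵇ-absent {a} {z ∷ _} (a≢z ∷ a∉zs) rewrite ≢⇒≡ᵇ-false a z a≢z = ∈ᵇ-absent a∉zs

filterᵇ-cong : ∀ {K K′ : A → Bool} {xs} → All (λ a → K a ≡ K′ a) xs → filterᵇ K xs ≡ filterᵇ K′ xs
filterᵇ-cong [] = refl
filterᵇ-cong {K = K} {K′ = K′} {x ∷ xs} (eq ∷ eqs) rewrite eq with K′ x
... | true  = cong (x ∷_) (filterᵇ-cong eqs)
... | false = filterᵇ-cong eqs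

filterᵇ-∈ᵇ : ∀ {zs xs} → Unique xs → zs ⊆ xs → filterᵇ (_∈ᵇ zs) xs ≡ zs
filterᵇ-∈ᵇ [] [] = refl
filterᵇ-∈ᵇ (x∉xs ∷ u) (x ∷ʳ zs⊆xs)
  rewrite ∈ᵇ-absent (Sublist.All-resp-⊆ zs⊆xs x∉xs) = filterᵇ-∈ᵇ u zs⊆xs
filterᵇ-∈ᵇ {z ∷ zs} {z ∷ xs} (z∉xs ∷ u) (refl ∷ zs⊆xs) rewrite ≡ᵇ-refl z =
  cong (z ∷_) (trans (filterᵇ-cong (All.map (λ {a} → agree a) z∉xs)) (filterᵇ-∈ᵇ u zs⊆xs))
  where
  agree : ∀ a → z ≢ a → (a ∈ᵇ (z ∷ zs)) ≡ (a ∈ᵇ zs)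
  agree a z≢a rewrite ≢⇒≡ᵇ-false a z (z≢a ∘ sym) = refl

-- Keep the symbols of the common subsequence `zs` and move all others. In a sequence without
-- repetitions, filtering by membership in `zs` returns `zs` in its own order.
Δ-sublist : ∀ {d} (x y : Perm d) {zs} → zs ⊆ seq x → zs ⊆ seq y → Δ x y + length zs ≤ d
Δ-sublist {d} x y {zs} zs⊆x zs⊆y = begin
  Δ x y + length zs
    ≤⟨ +-monoˡ-≤ _ (Δ-upper x y (_∈ᵇ zs) (trans zs≡ (sym (filterᵇ-∈ᵇ (unique-seq y) zs⊆y)))) ⟩
  ∑ (dropped (_∈ᵇ zs)) [1‥ d ] + length zs
    ≡⟨ cong₂ _+_ (sym (∑-↭ (dropped (_∈ᵇ zs)) (isPerm x))) (cong length (sym zs≡)) ⟩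
  ∑ (dropped (_∈ᵇ zs)) (seq x) + length (filterᵇ (_∈ᵇ zs) (seq x))
    ≡⟨ +-comm _ (length (filterᵇ (_∈ᵇ zs) (seq x))) ⟩
  length (filterᵇ (_∈ᵇ zs) (seq x)) + ∑ (dropped (_∈ᵇ zs)) (seq x)
    ≡⟨ length-filterᵇ (_∈ᵇ zs) (seq x) ⟩
  length (seq x)
    ≡⟨ length-seq x ⟩
  d ∎
  where
  open ≤-Reasoning
  zs≡ = filterᵇ-∈ᵇ (unique-seq x) zs⊆x

-- Ordering by majority vote

-- The test for `b` comes first, so no symbol precedes itself; when `b` is absent, the presence of
-- `a` suffices.
before : ℕ → ℕ → List ℕ → Bool
before a b []      = false
before a b (c ∷ x) = if c ≡ᵇ b then false else if c ≡ᵇ a then true else before a b x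

before-filterᵇ : ∀ (K : ℕ → Bool) {a b} → K a ≡ true → K b ≡ true →
  ∀ x → before a b (filterᵇ K x) ≡ before a b x
before-filterᵇ K         Ka Kb []      = refl
before-filterᵇ K {a} {b} Ka Kb (c ∷ x) with K c in Kc
... | true  = cong (λ r → if c ≡ᵇ b then false else if c ≡ᵇ a then true else r)
                   (before-filterᵇ K Ka Kb x)
... | false
  rewrite ≢⇒≡ᵇ-false c b (λ { refl → case trans (sym Kb) Kc of λ () })
        | ≢⇒≡ᵇ-false c a (λ { refl → case trans (sym Ka) Kc of λ () }) =
  before-filterᵇ K Ka Kb x

-- Consider the first of the three symbols met in `x`. The first hypothesis excludes `b`, the second
-- excludes `c`, and meeting `a` first refutes the closing comparison.
before-acyclic : ∀ a b c x →
  before a b x ≡ true → before b c x ≡ true → before c a x ≡ false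
before-acyclic a b c (e ∷ x) p q with e ≡ᵇ b | e ≡ᵇ c | e ≡ᵇ a
... | false | false | true  = refl
... | false | false | false = before-acyclic a b c x p q

-- Since `a` occurs, the search for it can fail only by meeting `b` first.
before-total : ∀ {a b y} → a ≢ b → a ∈ y → before a b y ≡ false → before b a y ≡ true
before-total {a} {b} {e ∷ y} a≢b a∈y eq with e ≡ᵇ b in eb | e ≡ᵇ a in ea
before-total {a} {b} {e ∷ y} a≢b a∈y eq | true  | true  =
  contradiction (trans (sym (≡ᵇ-true⇒≡ e a ea)) (≡ᵇ-true⇒≡ e b eb)) a≢b
before-total {a} {b} {e ∷ y} a≢b a∈y eq | true  | false = refl
before-total {a} {b} {e ∷ y} a≢b (here refl) eq | false | false =
  case trans (sym (≡ᵇ-refl a)) ea of λ ()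
before-total {a} {b} {e ∷ y} a≢b (there a∈y) eq | false | false = before-total a≢b a∈y eq

before-tail : ∀ {a b c} y → c ≢ a → before a b (c ∷ y) ≡ true → before a b y ≡ true
before-tail {a} {b} {c} y c≢a eq rewrite ≢⇒≡ᵇ-false c a c≢a with c ≡ᵇ b
... | false = eq

before-head : ∀ {a b c} y → before a b (c ∷ y) ≡ true → c ≢ b
before-head {a} {b} y eq refl rewrite ≡ᵇ-refl b = case eq of λ ()

∈-tail : ∀ {a c : ℕ} {y} → c ≢ a → a ∈ c ∷ y → a ∈ y
∈-tail c≢a (here refl) = contradiction refl c≢a
∈-tail c≢a (there a∈y) = a∈y

all-∈-tail : ∀ {c : ℕ} {y zs} → All (c ≢_) zs → All (_∈ c ∷ y) zs → All (_∈ y) zs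
all-∈-tail c∉zs zs∈ = All.zipWith (λ (c≢z , z∈) → ∈-tail c≢z z∈) (c∉zs , zs∈)

allPairs-before-tail : ∀ {c zs} y → All (c ≢_) zs →
  AllPairs (λ a b → before a b (c ∷ y) ≡ true) zs → AllPairs (λ a b → before a b y ≡ true) zs
allPairs-before-tail y []            []       = []
allPairs-before-tail y (c≢z ∷ c∉zs) (p ∷ ps) =
  All.map (before-tail y c≢z) p ∷ allPairs-before-tail y c∉zs ps

-- Greedy matching along `y`. A head `c` of `y` that differs from the next symbol `z` can be skipped
-- for good: `z` precedes all later symbols of `zs` in `c ∷ y`, so none of them is `c`.
allPairs-before⇒⊆ : ∀ {zs} y → All (_∈ y) zs →
  AllPairs (λ a b → before a b y ≡ true) zs → zs ⊆ y
allPairs-before⇒⊆ y       []       []       = minimum y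
allPairs-before⇒⊆ []      (() ∷ _) ps
allPairs-before⇒⊆ {z ∷ zs} (c ∷ y) (z∈ ∷ zs∈) (p ∷ ps) with c ≟ z
... | yes refl = refl ∷ allPairs-before⇒⊆ y (all-∈-tail c∉zs zs∈) (allPairs-before-tail y c∉zs ps)
  where
  c∉zs : All (c ≢_) zs
  c∉zs = All.map (before-head {z} y) p
... | no c≢z = c ∷ʳ allPairs-before⇒⊆ y (∈-tail c≢z z∈ ∷ all-∈-tail c∉zs zs∈)
                     (allPairs-before-tail y (c≢z ∷ c∉zs) (p ∷ ps))
  where
  c∉zs : All (c ≢_) zs
  c∉zs = All.map (before-head {z} y) p

Conflict : Set
Conflict = Maybe (ℕ × ℕ)

record ScanState : Set where
  constructor ⟨_,_,_⟩
  field
    conflict    : Conflict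
    front back  : List ℕ

open ScanState public

-- p w says that the symbol to be inserted should precede w.  Front collects
-- the symbols that should precede it and back those that should follow it,
-- until some w that should follow it is met right in front of some q that
-- should precede it: then w and q are taken out and the rest is only copied.
scanStep : (ℕ → Bool) → ℕ → ScanState → ScanState
scanStep p w ⟨ just c  , F , T ⟩ = ⟨ just c , w ∷ F , T ⟩
scanStep p w ⟨ nothing , F , T ⟩ with p w
scanStep p w ⟨ nothing , F     , T ⟩ | false = ⟨ nothing , w ∷ F , T ⟩
scanStep p w ⟨ nothing , []    , T ⟩ | true  = ⟨ nothing , [] , w ∷ T ⟩
scanStep p w ⟨ nothing , q ∷ F , T ⟩ | true  = ⟨ just (w , q) , F , T ⟩

scan : (ℕ → Bool) → List ℕ → ScanState
scan p = foldr (scanStep p) ⟨ nothing , [] , [] ⟩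

insert : ℕ → ScanState → List ℕ → List ℕ × List ℕ
insert a ⟨ nothing      , F , T ⟩ U = F ++ a ∷ T , U
insert a ⟨ just (w , q) , F , T ⟩ U = F ++ T , a ∷ w ∷ q ∷ U

order : (ℕ → ℕ → Bool) → List ℕ → List ℕ × List ℕ
order M []       = [] , []
order M (a ∷ xs) = insert a (scan (M a) (proj₁ (order M xs))) (proj₂ (order M xs))

ScanInvariant : (ℕ → ℕ → Set) → (ℕ → Bool) → List ℕ → ScanState → Set
ScanInvariant R p L ⟨ nothing      , F , T ⟩ =
  F ++ T ≡ L × All (λ w → p w ≡ false) F × All (λ w → p w ≡ true) T
ScanInvariant R p L ⟨ just (w , q) , F , T ⟩ =
  F ++ T ⊆ L × w ∷ q ∷ F ++ T ↭ L × p w ≡ true × p q ≡ false × R w q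

-- The scan runs from the right end, and before a conflict the suffix read so far is front followed
-- by back. The conflicting `w` arrives just ahead of `q`, the head of front, so `R w q` comes from
-- the order of the list itself.
scan-invariant : ∀ {R} p {L} → AllPairs R L → ScanInvariant R p L (scan p L)
scan-invariant p [] = refl , [] , []
scan-invariant {R} p {w ∷ L} (Rw ∷ RL) with scan p L | scan-invariant p RL
... | ⟨ just (v , q) , F , T ⟩ | sub , ↭L , pv , pq , Rvq =
  refl ∷ sub , ↭-trans (↭.shift w (v ∷ q ∷ []) (F ++ T)) (prep w ↭L) , pv , pq , Rvq
... | ⟨ nothing , F , T ⟩ | eq , pF , pT with p w in pw
scan-invariant {R} p {w ∷ L} (Rw ∷ RL) | ⟨ nothing , F     , T ⟩ | eq , pF , pT | false =
  cong (w ∷_) eq , pw ∷ pF , pT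
scan-invariant {R} p {w ∷ L} (Rw ∷ RL) | ⟨ nothing , []    , T ⟩ | eq , pF , pT | true =
  cong (w ∷_) eq , [] , pw ∷ pT
scan-invariant {R} p {w ∷ L} (Rw ∷ RL) | ⟨ nothing , q ∷ F , T ⟩ | refl , pq ∷ pF , pT | true =
  w ∷ʳ (q ∷ʳ ⊆-refl) , ↭-refl , pw , pq , All.head Rw

allPairs-insert : ∀ {R : ℕ → ℕ → Set} {a T} F → AllPairs R (F ++ T) →
  All (λ w → R w a) F → All (R a) T → AllPairs R (F ++ a ∷ T)
allPairs-insert []      RT         []          RaT = RaT ∷ RT
allPairs-insert (w ∷ F) (Rw ∷ RFT) (Rwa ∷ RFa) RaT =
  All.++⁺ (All.++⁻ˡ F Rw) (Rwa ∷ All.++⁻ʳ F Rw) ∷ allPairs-insert F RFT RFa RaT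

allPairs-⊆ : ∀ {R : ℕ → ℕ → Set} {zs xs} → zs ⊆ xs → AllPairs R xs → AllPairs R zs
allPairs-⊆ []             []       = []
allPairs-⊆ (x ∷ʳ zs⊆xs)   (_ ∷ Rs) = allPairs-⊆ zs⊆xs Rs
allPairs-⊆ (refl ∷ zs⊆xs) (R ∷ Rs) = Sublist.All-resp-⊆ zs⊆xs R ∷ allPairs-⊆ zs⊆xs Rs

-- G marks the good symbols.
module Ordering (M : ℕ → ℕ → Bool) (G : ℕ → Bool) (y : List ℕ)
  (agree : ∀ {a b} → G a ≡ true → G b ≡ true → M a b ≡ before a b y) where

  -- Nothing is claimed about a pair with a bad symbol, so the invariant can speak of the whole list
  -- although `G` is unknown to the algorithm.
  InOrder : ℕ → ℕ → Set
  InOrder a b = G a ≡ true → G b ≡ true → before a b y ≡ true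

  OrderInvariant : List ℕ → List ℕ × List ℕ → Set
  OrderInvariant xs (L , U) =
    L ++ U ↭ xs × AllPairs InOrder L × length U ≤ 3 * ∑ (dropped G) U

  -- Were all three good, votes and list order would be those of `y` and give the cycle `a`, `w`,
  -- `q`, `a` there. This is the charge for discarding a triple.
  triangle-bad : ∀ {a w q} → a ≢ q → a ∈ y → M a w ≡ true → M a q ≡ false → InOrder w q →
    1 ≤ dropped G a + (dropped G w + dropped G q)
  triangle-bad {a} {w} {q} a≢q a∈y Maw Maq Rwq with G a in Ga | G w in Gw | G q in Gq
  ... | false | _     | _     = s≤s z≤n
  ... | true  | false | _     = s≤s z≤n
  ... | true  | true  | false = s≤s z≤n
  ... | true  | true  | true  = case trans (sym q<a) (before-acyclic a w q y a<w (Rwq refl refl)) of λ ()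
    where
    a<w = trans (sym (agree Ga Gw)) Maw
    q<a = before-total a≢q a∈y (trans (sym (agree Ga Gq)) Maq)

  insert-invariant : ∀ {a xs L U} → a ∈ y → All (a ≢_) xs → OrderInvariant xs (L , U) →
    OrderInvariant (a ∷ xs) (insert a (scan (M a) L) U)
  insert-invariant {a} {xs} {L} {U} a∈y a∉xs (↭xs , RL , U≤)
    with scan (M a) L | scan-invariant (M a) RL
  ... | ⟨ nothing , F , T ⟩ | refl , MF , MT =
    ↭-trans (↭.++⁺ʳ U (↭.shift a F T)) (prep a ↭xs) ,
    allPairs-insert F RL (All.zipWith front-in-order (All.++⁻ˡ F a∉L , MF)) (All.map back-in-order MT) ,
    U≤
    where
    a∉L : All (a ≢_) (F ++ T)
    a∉L = All.++⁻ˡ (F ++ T) (↭.All-resp-↭ (↭-sym ↭xs) a∉xs)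

    front-in-order : ∀ {w} → (a ≢ w) × (M a w ≡ false) → InOrder w a
    front-in-order (a≢w , Maw) Gw Ga = before-total a≢w a∈y (trans (sym (agree Ga Gw)) Maw)

    back-in-order : ∀ {w} → M a w ≡ true → InOrder a w
    back-in-order Maw Ga Gw = trans (sym (agree Ga Gw)) Maw
  ... | ⟨ just (w , q) , F , T ⟩ | sub , ↭L , Maw , Maq , Rwq =
    (begin
      (F ++ T) ++ a ∷ w ∷ q ∷ U   ↭⟨ ↭.++-comm (F ++ T) (a ∷ w ∷ q ∷ U) ⟩
      a ∷ w ∷ q ∷ U ++ (F ++ T)   ↭⟨ ↭.++⁺ˡ (a ∷ w ∷ q ∷ []) (↭.++-comm U (F ++ T)) ⟩
      a ∷ (w ∷ q ∷ F ++ T) ++ U   ↭⟨ prep a (↭.++⁺ʳ U ↭L) ⟩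
      a ∷ L ++ U                  ↭⟨ prep a ↭xs ⟩
      a ∷ xs                      ∎) ,
    allPairs-⊆ sub RL ,
    ≤-trans (+-monoʳ-≤ 3 U≤)
      (≤-trans (+-monoˡ-≤ _ (*-monoʳ-≤ 3 (triangle-bad a≢q a∈y Maw Maq Rwq)))
        (≤-reflexive (regroup (dropped G a) (dropped G w) (dropped G q) (∑ (dropped G) U))))
    where
    open PermutationReasoning

    a≢q : a ≢ q
    a≢q = All.head (All.tail (↭.All-resp-↭ (↭-sym ↭L)
            (All.++⁻ˡ L (↭.All-resp-↭ (↭-sym ↭xs) a∉xs))))

    regroup : ∀ i j k l → 3 * (i + (j + k)) + 3 * l ≡ 3 * (i + (j + (k + l)))
    regroup = solve-∀

  order-invariant : ∀ {xs} → All (_∈ y) xs → Unique xs → OrderInvariant xs (order M xs)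
  order-invariant []          []         = ↭-refl , [] , z≤n
  order-invariant (a∈y ∷ xs∈) (a∉xs ∷ u) = insert-invariant a∈y a∉xs (order-invariant xs∈ u)

order-↭ : ∀ M {xs} → Unique xs → proj₁ (order M xs) ++ proj₂ (order M xs) ↭ xs
order-↭ M {xs} u = proj₁ (order-invariant (All.tabulate (λ a∈ → a∈)) u)
  -- Being a rearrangement concerns no median: with no symbol declared good, agreement with the vote
  -- is vacuous.
  where open Ordering M (λ _ → false) xs (λ ())

-- The candidate given by the majority order

votes : ∀ {d} → List (Perm d) → ℕ → ℕ → ℕ
votes S a b = ∑ (λ x → bit (before a b (seq x))) S

-- True when at least half are in favour, ties included. The truncated subtraction mirrors the
-- program, which starts from the length of `S` and takes off two per vote.
majority : ∀ {d} → List (Perm d) → ℕ → ℕ → Bool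
majority S a b = (length S ∸ 2 * votes S a b) ≡ᵇ 0

-- Descending, as a fold over the unary numeral `d` produces them.
symbols : ℕ → List ℕ
symbols = applyDownFrom suc

symbols-↭ : ∀ d → symbols d ↭ [1‥ d ]
symbols-↭ d = subst (_↭ [1‥ d ]) (reverse-applyUpTo suc d) (↭.↭-reverse [1‥ d ])

unique-symbols : ∀ d → Unique (symbols d)
unique-symbols d = unique-resp-↭ (↭-sym (symbols-↭ d)) (unique-[1‥] d)

arrangement : ∀ {d} → List (Perm d) → List ℕ × List ℕ
arrangement {d} S = order (majority S) (symbols d)

arrangement-↭ : ∀ {d} (S : List (Perm d)) →
  proj₁ (arrangement S) ++ proj₂ (arrangement S) ↭ [1‥ d ]
arrangement-↭ {d} S =
  ↭-trans (order-↭ (majority S) (unique-symbols d)) (symbols-↭ d)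

candidate : ∀ {d} → List (Perm d) → Perm d
candidate S = perm (proj₁ (arrangement S) ++ proj₂ (arrangement S)) (arrangement-↭ S)

-- The two candidates and the approximation ratio

module Analysis {d : ℕ} (S : List (Perm d)) (y : Perm d) where

  n : ℕ
  n = length S

  moved : Perm d → ℕ → ℕ
  moved x = dropped (unmoved x y)

  moves : ℕ → ℕ
  moves a = ∑ (λ x → moved x a) S

  good : ℕ → Bool
  good a = 4 * moves a <ᵇ n

  bad : ℕ → ℕ
  bad = dropped good

  before-unmoved : ∀ x {a b} → unmoved x y a ≡ true → unmoved x y b ≡ true →
    before a b (seq x) ≡ before a b (seq y)
  before-unmoved x {a} {b} Ka Kb = begin
    before a b (seq x)                            ≡⟨ before-filterᵇ (unmoved x y) Ka Kb (seq x) ⟨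
    before a b (filterᵇ (unmoved x y) (seq x))    ≡⟨ cong (before a b) (unmoved-aligned x y) ⟩
    before a b (filterᵇ (unmoved x y) (seq y))    ≡⟨ before-filterᵇ (unmoved x y) Ka Kb (seq y) ⟩
    before a b (seq y)                            ∎
    where open ≡-Reasoning

  -- If `x` moves neither symbol the two comparisons coincide; otherwise the added term is at least
  -- 1 and covers any difference.
  vote-moved : ∀ x a b → bit (before a b (seq y)) ≤ bit (before a b (seq x)) + (moved x a + moved x b)
                       × bit (before a b (seq x)) ≤ bit (before a b (seq y)) + (moved x a + moved x b)
  vote-moved x a b with unmoved x y a in Ka | unmoved x y b in Kb
  ... | true  | true  rewrite before-unmoved x Ka Kb = m≤m+n _ _ , m≤m+n _ _
  ... | true  | false = ≤-trans (bit≤1 _) (m≤n+m 1 _) , ≤-trans (bit≤1 _) (m≤n+m 1 _)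
    where
    bit≤1 : ∀ p → bit p ≤ 1
    bit≤1 true  = ≤-refl
    bit≤1 false = z≤n
  ... | false | k     =
    ≤-trans (bit≤ _) (m≤n+m _ (bit (before a b (seq x)))) ,
    ≤-trans (bit≤ _) (m≤n+m _ (bit (before a b (seq y))))
    where
    bit≤ : ∀ p → bit p ≤ suc (bit (not k))
    bit≤ true  = s≤s z≤n
    bit≤ false = z≤n

  votes-lower : ∀ a b → n * bit (before a b (seq y)) ≤ votes S a b + (moves a + moves b)
  votes-lower a b = begin
    n * bit (before a b (seq y))
      ≡⟨ ∑-const _ S ⟨
    ∑ (λ _ → bit (before a b (seq y))) S
      ≤⟨ ∑-mono (λ x → proj₁ (vote-moved x a b)) S ⟩
    ∑ (λ x → bit (before a b (seq x)) + (moved x a + moved x b)) S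
      ≡⟨ ∑-distrib-+ (λ x → bit (before a b (seq x))) (λ x → moved x a + moved x b) S ⟩
    votes S a b + ∑ (λ x → moved x a + moved x b) S
      ≡⟨ cong (votes S a b +_) (∑-distrib-+ (λ x → moved x a) (λ x → moved x b) S) ⟩
    votes S a b + (moves a + moves b) ∎
    where open ≤-Reasoning

  votes-upper : ∀ a b → votes S a b ≤ n * bit (before a b (seq y)) + (moves a + moves b)
  votes-upper a b = begin
    votes S a b
      ≤⟨ ∑-mono (λ x → proj₂ (vote-moved x a b)) S ⟩
    ∑ (λ x → bit (before a b (seq y)) + (moved x a + moved x b)) S
      ≡⟨ ∑-distrib-+ (λ x → bit (before a b (seq y))) (λ x → moved x a + moved x b) S ⟩
    ∑ (λ _ → bit (before a b (seq y))) S + ∑ (λ x → moved x a + moved x b) S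
      ≡⟨ cong₂ _+_ (∑-const _ S) (∑-distrib-+ (λ x → moved x a) (λ x → moved x b) S) ⟩
    n * bit (before a b (seq y)) + (moves a + moves b) ∎
    where open ≤-Reasoning

  good⇒< : ∀ a → good a ≡ true → 4 * moves a < n
  good⇒< a eq = <ᵇ⇒< _ _ (subst T (sym eq) _)

  ¬good⇒≥ : ∀ a → good a ≡ false → n ≤ 4 * moves a
  ¬good⇒≥ a eq = ≮⇒≥ λ lt → subst T eq (<⇒<ᵇ lt)

  -- The number of votes differs from the unanimous 0 or `n` by at most `moves a + moves b`, which
  -- goodness keeps below `n / 2`.
  majority-agrees : ∀ {a b} → good a ≡ true → good b ≡ true →
    majority S a b ≡ before a b (seq y)
  majority-agrees {a} {b} Ga Gb with before a b (seq y) | votes-lower a b | votes-upper a b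
  ... | true | lower | _ = cong (_≡ᵇ 0) (m≤n⇒m∸n≡0 2votes≥n)
    where
    v = votes S a b
    2votes≥n : n ≤ 2 * v
    2votes≥n = *-cancelˡ-≤ 2 (+-cancelʳ-≤ (2 * n) _ _ (begin
      2 * n + 2 * n                         ≡⟨ quadruple n ⟩
      4 * (n * 1)                           ≤⟨ *-monoʳ-≤ 4 lower ⟩
      4 * (v + (moves a + moves b))         ≡⟨ split v (moves a) (moves b) ⟩
      2 * (2 * v) + (4 * moves a + 4 * moves b)
        ≤⟨ +-monoʳ-≤ (2 * (2 * v)) (+-mono-≤ (<⇒≤ (good⇒< a Ga)) (<⇒≤ (good⇒< b Gb))) ⟩
      2 * (2 * v) + (n + n)                 ≡⟨ cong (2 * (2 * v) +_) (cong (n +_) (sym (+-identityʳ n))) ⟩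
      2 * (2 * v) + 2 * n                   ∎))
      where
      open ≤-Reasoning
      quadruple : ∀ m → 2 * m + 2 * m ≡ 4 * (m * 1)
      quadruple = solve-∀
      split : ∀ v a b → 4 * (v + (a + b)) ≡ 2 * (2 * v) + (4 * a + 4 * b)
      split = solve-∀
  -- A tie would count in favour, so here the strictness in the definition of `good` is essential.
  ... | false | _ | upper = ≢⇒≡ᵇ-false (n ∸ 2 * v) 0 (m>n⇒m∸n≢0 2votes<n)
    where
    v = votes S a b
    2votes<n : 2 * v < n
    2votes<n = *-cancelˡ-< 2 _ _ (begin-strict
      2 * (2 * v)                           ≡⟨ *-assoc 2 2 v ⟨
      4 * v                                 ≤⟨ *-monoʳ-≤ 4 upper ⟩
      4 * (n * 0 + (moves a + moves b))     ≡⟨ split n (moves a) (moves b) ⟩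
      4 * moves a + 4 * moves b             <⟨ +-mono-< (good⇒< a Ga) (good⇒< b Gb) ⟩
      n + n                                 ≡⟨ cong (n +_) (+-identityʳ n) ⟨
      2 * n                                 ∎)
      where
      open ≤-Reasoning
      split : ∀ m a b → 4 * (m * 0 + (a + b)) ≡ 4 * a + 4 * b
      split = solve-∀

  -- The good symbols of `L` form a common subsequence of `y` and the candidate. Missing from it are
  -- the bad symbols of `L` and all of `U`, and the latter is at most three times its number of bad
  -- symbols.
  Δ-candidate : Δ y (candidate S) ≤ 3 * ∑ bad [1‥ d ]
  Δ-candidate with order-invariant all∈y (unique-symbols d)
    where
    open Ordering (majority S) good (seq y) majority-agrees
    all∈y : All (_∈ seq y) (symbols d)
    all∈y = All.tabulate (↭.∈-resp-↭ (↭-trans (symbols-↭ d) (↭-sym (isPerm y))))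
  ... | _ , inOrder , U≤ = +-cancelʳ-≤ (length zs) _ _ (begin
    Δ y (candidate S) + length zs
      ≤⟨ Δ-sublist y (candidate S) zs⊆y zs⊆z ⟩
    d
      ≡⟨ length-seq (candidate S) ⟨
    length (L ++ U)
      ≡⟨ length-++ L ⟩
    length L + length U
      ≡⟨ cong (_+ length U) (length-filterᵇ good L) ⟨
    length zs + ∑ bad L + length U
      ≤⟨ +-mono-≤ (+-monoʳ-≤ (length zs) (m≤m+n (∑ bad L) _)) U≤ ⟩
    length zs + 3 * ∑ bad L + 3 * ∑ bad U
      ≡⟨ regroup (length zs) (∑ bad L) (∑ bad U) ⟩
    3 * (∑ bad L + ∑ bad U) + length zs
      ≡⟨ cong (λ s → 3 * s + length zs) (∑-++ bad L U) ⟨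
    3 * ∑ bad (L ++ U) + length zs
      ≡⟨ cong (λ s → 3 * s + length zs) (∑-↭ bad (arrangement-↭ S)) ⟩
    3 * ∑ bad [1‥ d ] + length zs ∎)
    where
    open ≤-Reasoning
    L = proj₁ (arrangement S)
    U = proj₂ (arrangement S)
    zs = filterᵇ good L

    zs⊆L : zs ⊆ L
    zs⊆L = Sublist.filter-⊆ (T? ∘ good) L

    zs⊆z : zs ⊆ L ++ U
    zs⊆z = Sublist.++⁺ʳ U zs⊆L

    all-good : All (λ a → good a ≡ true) zs
    all-good = All.map (Equivalence.to T-≡) (All.all-filter (T? ∘ good) L)

    zs⊆y : zs ⊆ seq y
    zs⊆y = allPairs-before⇒⊆ (seq y)
      (All.tabulate λ a∈ → ↭.∈-resp-↭ (seq-↭ (candidate S) y) (Sublist.Any-resp-⊆ zs⊆z a∈))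
      (before-pairs all-good (allPairs-⊆ zs⊆L inOrder))
      where
      before-pairs : ∀ {zs} → All (λ a → good a ≡ true) zs →
        AllPairs (λ a b → good a ≡ true → good b ≡ true → before a b (seq y) ≡ true) zs →
        AllPairs (λ a b → before a b (seq y) ≡ true) zs
      before-pairs []       []       = []
      before-pairs (g ∷ gs) (p ∷ ps) =
        All.zipWith (λ (r , gb) → r g gb) (p , gs) ∷ before-pairs gs ps

    regroup : ∀ l s t → l + 3 * s + 3 * t ≡ 3 * (s + t) + l
    regroup = solve-∀

  opt badMoves : ℕ
  opt      = cost S y
  badMoves = ∑ (λ a → bad a * moves a) [1‥ d ]

  ∑-moves≤opt : ∑ moves [1‥ d ] ≤ opt
  ∑-moves≤opt = ≤-trans (≤-reflexive (∑-swap (λ a x → moved x a) [1‥ d ] S))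
                        (∑-mono (λ x → ∑-moved≤Δ x y) S)

  n*bad≤ : n * ∑ bad [1‥ d ] ≤ 4 * badMoves
  n*bad≤ = subst₂ _≤_ (∑-distribˡ-* n bad [1‥ d ]) (∑-distribˡ-* 4 (λ a → bad a * moves a) [1‥ d ])
    (∑-mono pointwise [1‥ d ])
    where
    pointwise : ∀ a → n * bad a ≤ 4 * (bad a * moves a)
    pointwise a with good a in eq
    ... | true  = ≤-trans (≤-reflexive (*-zeroʳ n)) z≤n
    ... | false = subst₂ _≤_ (sym (*-identityʳ n)) (cong (4 *_) (sym (+-identityʳ (moves a)))) (¬good⇒≥ a eq)

  cost-candidate : cost S (candidate S) ≤ opt + 12 * badMoves
  cost-candidate = begin
    cost S (candidate S)                        ≤⟨ ∑-mono (λ x → Δ-triangle x y (candidate S)) S ⟩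
    ∑ (λ x → Δ x y + Δ y (candidate S)) S       ≡⟨ ∑-distrib-+ (λ x → Δ x y) (λ _ → Δ y (candidate S)) S ⟩
    opt + ∑ (λ _ → Δ y (candidate S)) S         ≡⟨ cong (opt +_) (∑-const _ S) ⟩
    opt + n * Δ y (candidate S)                 ≤⟨ +-monoʳ-≤ opt (*-monoʳ-≤ n Δ-candidate) ⟩
    opt + n * (3 * ∑ bad [1‥ d ])               ≡⟨ cong (opt +_) (rotate n (∑ bad [1‥ d ])) ⟩
    opt + 3 * (n * ∑ bad [1‥ d ])               ≤⟨ +-monoʳ-≤ opt (*-monoʳ-≤ 3 n*bad≤) ⟩
    opt + 3 * (4 * badMoves)                    ≡⟨ cong (opt +_) (*-assoc 3 4 badMoves) ⟨
    opt + 12 * badMoves                         ∎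
    where
    open ≤-Reasoning
    rotate : ∀ m b → m * (3 * b) ≡ 3 * (m * b)
    rotate = solve-∀

  moved∪ : Perm d → Perm d → ℕ → ℕ
  moved∪ x x′ = dropped (λ a → unmoved x′ y a ∧ unmoved x y a)

  moved∪-inclusion-exclusion : ∀ x x′ a →
    moved∪ x x′ a + moved x a * moved x′ a ≡ moved x a + moved x′ a
  moved∪-inclusion-exclusion x x′ a with unmoved x y a | unmoved x′ y a
  ... | true  | true  = refl
  ... | true  | false = refl
  ... | false | true  = refl
  ... | false | false = refl

  -- Erase whatever `x` or `x′` moves: what remains of either is what remains of `y`.
  Δ-pair : ∀ x x′ → Δ x x′ ≤ ∑ (moved∪ x x′) [1‥ d ]
  Δ-pair x x′ = Δ-upper x x′ (λ a → K′ a ∧ K a) (begin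
    filterᵇ (λ a → K′ a ∧ K a) (seq x)   ≡⟨ filterᵇ-∧ K′ K (seq x) ⟩
    filterᵇ K′ (filterᵇ K (seq x))       ≡⟨ cong (filterᵇ K′) (unmoved-aligned x y) ⟩
    filterᵇ K′ (filterᵇ K (seq y))       ≡⟨ filterᵇ-comm K′ K (seq y) ⟩
    filterᵇ K (filterᵇ K′ (seq y))       ≡⟨ cong (filterᵇ K) (unmoved-aligned x′ y) ⟨
    filterᵇ K (filterᵇ K′ (seq x′))      ≡⟨ filterᵇ-comm K K′ (seq x′) ⟩
    filterᵇ K′ (filterᵇ K (seq x′))      ≡⟨ filterᵇ-∧ K′ K (seq x′) ⟨
    filterᵇ (λ a → K′ a ∧ K a) (seq x′)  ∎)
    where
    open ≡-Reasoning
    K  = unmoved x y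
    K′ = unmoved x′ y

  pairs : ℕ → ℕ
  pairs a = ∑ (λ x′ → ∑ (λ x → moved∪ x x′ a) S) S

  ∑-cost≤ : ∑ (cost S) S ≤ ∑ pairs [1‥ d ]
  ∑-cost≤ = begin
    ∑ (λ x′ → ∑ (λ x → Δ x x′) S) S
      ≤⟨ ∑-mono (λ x′ → ∑-mono (λ x → Δ-pair x x′) S) S ⟩
    ∑ (λ x′ → ∑ (λ x → ∑ (moved∪ x x′) [1‥ d ]) S) S
      ≡⟨ ∑-cong (λ x′ → ∑-swap (λ x → moved∪ x x′) S [1‥ d ]) S ⟩
    ∑ (λ x′ → ∑ (λ a → ∑ (λ x → moved∪ x x′ a) S) [1‥ d ]) S
      ≡⟨ ∑-swap (λ x′ a → ∑ (λ x → moved∪ x x′ a) S) S [1‥ d ] ⟩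
    ∑ pairs [1‥ d ] ∎
    where open ≤-Reasoning

  -- With `c = moves a`, the ordered pairs in which at least one member moves `a` number
  -- `n² - (n - c)²`. The identity is stated without subtraction and obtained by summing
  -- inclusion-exclusion.
  pairs-square : ∀ a → pairs a + moves a * moves a ≡ 2 * (n * moves a)
  pairs-square a = begin
    pairs a + c * c
      ≡⟨ cong (pairs a +_) (∑-distribˡ-* c (λ x′ → moved x′ a) S) ⟨
    pairs a + ∑ (λ x′ → c * moved x′ a) S
      ≡⟨ ∑-distrib-+ (λ x′ → ∑ (λ x → moved∪ x x′ a) S) (λ x′ → c * moved x′ a) S ⟨
    ∑ (λ x′ → ∑ (λ x → moved∪ x x′ a) S + c * moved x′ a) S
      ≡⟨ ∑-cong inner S ⟩
    ∑ (λ x′ → c + n * moved x′ a) S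
      ≡⟨ ∑-distrib-+ (λ _ → c) (λ x′ → n * moved x′ a) S ⟩
    ∑ (λ _ → c) S + ∑ (λ x′ → n * moved x′ a) S
      ≡⟨ cong₂ _+_ (∑-const c S) (∑-distribˡ-* n (λ x′ → moved x′ a) S) ⟩
    n * c + n * c
      ≡⟨ cong (n * c +_) (+-identityʳ (n * c)) ⟨
    2 * (n * c) ∎
    where
    open ≡-Reasoning
    c = moves a
    inner : ∀ x′ → ∑ (λ x → moved∪ x x′ a) S + c * moved x′ a ≡ c + n * moved x′ a
    inner x′ = begin
      ∑ (λ x → moved∪ x x′ a) S + c * i′
        ≡⟨ cong (∑ (λ x → moved∪ x x′ a) S +_)
             (trans (*-comm c i′) (sym (∑-distribˡ-* i′ (λ x → moved x a) S))) ⟩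
      ∑ (λ x → moved∪ x x′ a) S + ∑ (λ x → i′ * moved x a) S
        ≡⟨ ∑-distrib-+ (λ x → moved∪ x x′ a) (λ x → i′ * moved x a) S ⟨
      ∑ (λ x → moved∪ x x′ a + i′ * moved x a) S
        ≡⟨ ∑-cong (λ x → trans (cong (moved∪ x x′ a +_) (*-comm i′ (moved x a)))
                               (moved∪-inclusion-exclusion x x′ a)) S ⟩
      ∑ (λ x → moved x a + i′) S
        ≡⟨ ∑-distrib-+ (λ x → moved x a) (λ _ → i′) S ⟩
      c + ∑ (λ _ → i′) S
        ≡⟨ cong (c +_) (∑-const i′ S) ⟩
      c + n * i′ ∎
      where i′ = moved x′ a

  -- For a bad symbol `4c ≥ n`, so the square is worth at least `n c / 4`; for a good one the square
  -- is given away.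
  pairs-saving : ∀ a → 4 * pairs a + n * (bad a * moves a) ≤ 8 * n * moves a
  pairs-saving a = begin
    4 * pairs a + n * (bad a * c)   ≤⟨ +-monoʳ-≤ (4 * pairs a) saving ⟩
    4 * pairs a + 4 * (c * c)       ≡⟨ *-distribˡ-+ 4 (pairs a) (c * c) ⟨
    4 * (pairs a + c * c)           ≡⟨ cong (4 *_) (pairs-square a) ⟩
    4 * (2 * (n * c))               ≡⟨ eightfold n c ⟩
    8 * n * c                       ∎
    where
    open ≤-Reasoning
    c = moves a
    eightfold : ∀ m c → 4 * (2 * (m * c)) ≡ 8 * m * c
    eightfold = solve-∀
    saving : n * (bad a * c) ≤ 4 * (c * c)
    saving with good a in eq
    ... | true  = ≤-trans (≤-reflexive (*-zeroʳ n)) z≤n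
    ... | false = begin
      n * (c + 0)    ≡⟨ cong (n *_) (+-identityʳ c) ⟩
      n * c          ≤⟨ *-monoˡ-≤ c (¬good⇒≥ a eq) ⟩
      4 * c * c      ≡⟨ *-assoc 4 c c ⟩
      4 * (c * c)    ∎

  ∑-cost-saving : 4 * ∑ (cost S) S + n * badMoves ≤ n * (8 * opt)
  ∑-cost-saving = begin
    4 * ∑ (cost S) S + n * badMoves
      ≤⟨ +-monoˡ-≤ (n * badMoves) (*-monoʳ-≤ 4 ∑-cost≤) ⟩
    4 * ∑ pairs [1‥ d ] + n * badMoves
      ≡⟨ cong₂ _+_ (∑-distribˡ-* 4 pairs [1‥ d ]) (∑-distribˡ-* n (λ a → bad a * moves a) [1‥ d ]) ⟨
    ∑ (λ a → 4 * pairs a) [1‥ d ] + ∑ (λ a → n * (bad a * moves a)) [1‥ d ]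
      ≡⟨ ∑-distrib-+ (λ a → 4 * pairs a) (λ a → n * (bad a * moves a)) [1‥ d ] ⟨
    ∑ (λ a → 4 * pairs a + n * (bad a * moves a)) [1‥ d ]
      ≤⟨ ∑-mono pairs-saving [1‥ d ] ⟩
    ∑ (λ a → 8 * n * moves a) [1‥ d ]
      ≡⟨ ∑-distribˡ-* (8 * n) moves [1‥ d ] ⟩
    8 * n * ∑ moves [1‥ d ]
      ≤⟨ *-monoʳ-≤ (8 * n) ∑-moves≤opt ⟩
    8 * n * opt
      ≡⟨ rotate n opt ⟩
    n * (8 * opt) ∎
    where
    open ≤-Reasoning
    rotate : ∀ m q → 8 * m * q ≡ m * (8 * q)
    rotate = solve-∀

  module _ (z : Perm d) (z≤S : All (λ x → cost S z ≤ cost S x) S) where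

    n*cost≤ : n * cost S z ≤ ∑ (cost S) S
    n*cost≤ = go z≤S
      where
      go : ∀ {xs} → All (λ x → cost S z ≤ cost S x) xs → length xs * cost S z ≤ ∑ (cost S) xs
      go []       = z≤n
      go (p ∷ ps) = +-mono-≤ p (go ps)

    -- The cheapest member of `S` costs no more than the average; the common factor `n` cancels.
    cost-saving : 0 < n → 4 * cost S z + badMoves ≤ 8 * opt
    cost-saving 0<n = *-cancelˡ-≤ n {{>-nonZero 0<n}} (begin
      n * (4 * cost S z + badMoves)    ≡⟨ expand n (cost S z) badMoves ⟩
      4 * (n * cost S z) + n * badMoves ≤⟨ +-monoˡ-≤ (n * badMoves) (*-monoʳ-≤ 4 n*cost≤) ⟩
      4 * ∑ (cost S) S + n * badMoves  ≤⟨ ∑-cost-saving ⟩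
      n * (8 * opt)                    ∎)
      where
      open ≤-Reasoning
      expand : ∀ m c b → m * (4 * c + b) ≡ 4 * (m * c) + m * b
      expand = solve-∀

    approximation : cost S z ≤ cost S (candidate S) → 49 * cost S z ≤ 97 * opt
    approximation z≤candidate with n ≟ 0
    ... | yes n≡0 = subst (λ c → 49 * c ≤ 97 * opt) (sym (cost-empty S n≡0)) z≤n
      where
      cost-empty : ∀ T → length T ≡ 0 → cost T z ≡ 0
      cost-empty [] _ = refl
    ... | no n≢0 = +-cancelʳ-≤ (12 * badMoves) _ _ (begin
      49 * cost S z + 12 * badMoves               ≡⟨ split (cost S z) badMoves ⟩
      cost S z + 12 * (4 * cost S z + badMoves)
        -- One copy of the candidate bound and twelve of the averaging bound: the terms in
        -- `badMoves` then balance.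
        ≤⟨ +-mono-≤ (≤-trans z≤candidate cost-candidate) (*-monoʳ-≤ 12 (cost-saving (n≢0⇒n>0 n≢0))) ⟩
      opt + 12 * badMoves + 12 * (8 * opt)        ≡⟨ merge opt badMoves ⟩
      97 * opt + 12 * badMoves                    ∎)
      where
      open ≤-Reasoning
      split : ∀ c b → 49 * c + 12 * b ≡ c + 12 * (4 * c + b)
      split = solve-∀
      merge : ∀ q b → q + 12 * b + 12 * (8 * q) ≡ 97 * q + 12 * b
      merge = solve-∀

-- The Ulam distance by longest common subsequences

lcs : List ℕ → List ℕ → ℕ
lcs []      y       = 0
lcs (a ∷ x) []      = 0
lcs (a ∷ x) (b ∷ y) =
  (lcs x (b ∷ y) ⊔ lcs (a ∷ x) y) ⊔ (if a ≡ᵇ b then suc (lcs x y) else 0)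

lcs-zeroʳ : ∀ x → lcs x [] ≡ 0
lcs-zeroʳ []      = refl
lcs-zeroʳ (a ∷ x) = refl

-- A dropped head is skipped on its own side, and two kept heads coincide by the equation. The
-- recursion is on `x` outside and on `y` inside, like the table.
lcs-maximal : ∀ (K : ℕ → Bool) x y → filterᵇ K x ≡ filterᵇ K y → length (filterᵇ K x) ≤ lcs x y
lcs-maximal K []      y = λ _ → z≤n
lcs-maximal K (a ∷ x) y = scanning y
  where
  scanning : ∀ y → filterᵇ K (a ∷ x) ≡ filterᵇ K y → length (filterᵇ K (a ∷ x)) ≤ lcs (a ∷ x) y
  scanning []      eq = subst (λ zs → length zs ≤ 0) (sym eq) z≤n
  scanning (b ∷ y) eq with K a in Ka
  ... | false = ≤-trans (lcs-maximal K x (b ∷ y) eq) (m≤n⇒m≤n⊔o _ (m≤m⊔n _ _))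
  ... | true with K b in Kb
  ...   | false = ≤-trans (subst (_≤ lcs (a ∷ x) y) (cong length (filterᵇ-accept K x Ka))
                            (scanning y (trans (filterᵇ-accept K x Ka) eq)))
                          (m≤n⇒m≤n⊔o _ (m≤n⊔m (lcs x (b ∷ y)) _))
  ...   | true with ∷-injective eq
  ...     | refl , eq′ rewrite ≡ᵇ-refl a = ≤-trans (s≤s (lcs-maximal K x y eq′)) (m≤n⊔m _ _)

lcs-attained : ∀ x y → ∃ λ zs → zs ⊆ x × zs ⊆ y × length zs ≡ lcs x y
lcs-attained []      y  = [] , [] , minimum y , refl
lcs-attained (a ∷ x) [] = [] , minimum (a ∷ x) , [] , refl
lcs-attained (a ∷ x) (b ∷ y) =
  larger (larger (skipˡ (lcs-attained x (b ∷ y))) (skipʳ (lcs-attained (a ∷ x) y))) match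
  where
  Common : ℕ → Set
  Common k = ∃ λ zs → zs ⊆ a ∷ x × zs ⊆ b ∷ y × length zs ≡ k

  skipˡ : ∀ {k} → (∃ λ zs → zs ⊆ x × zs ⊆ b ∷ y × length zs ≡ k) → Common k
  skipˡ (zs , p , q , eq) = zs , a ∷ʳ p , q , eq

  skipʳ : ∀ {k} → (∃ λ zs → zs ⊆ a ∷ x × zs ⊆ y × length zs ≡ k) → Common k
  skipʳ (zs , p , q , eq) = zs , p , b ∷ʳ q , eq

  larger : ∀ {k l} → Common k → Common l → Common (k ⊔ l)
  larger {k} {l} p q with ⊔-sel k l
  ... | inj₁ eq = subst Common (sym eq) p
  ... | inj₂ eq = subst Common (sym eq) q

  match : Common (if a ≡ᵇ b then suc (lcs x y) else 0)
  match with a ≡ᵇ b in eq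
  ... | false = [] , minimum _ , minimum _ , refl
  ... | true with ≡ᵇ-true⇒≡ a b eq | lcs-attained x y
  ...   | refl | zs , p , q , eq′ = a ∷ zs , refl ∷ p , refl ∷ q , cong suc eq′

lcs≤length : ∀ x y → lcs x y ≤ length y
lcs≤length x y with lcs-attained x y
... | zs , _ , zs⊆y , eq = subst (_≤ length y) eq (Sublist.length-mono-≤ zs⊆y)

-- `Δ` is defined by a search through sequences of moves; this identity lets the program compute it
-- from a table. The symbols left alone by an optimal sequence form a common subsequence, and any
-- common subsequence can be left alone.
Δ≡d∸lcs : ∀ {d} (x y : Perm d) → Δ x y ≡ d ∸ lcs (seq x) (seq y)
Δ≡d∸lcs {d} x y = ≤-antisym upper lower
  where
  open ≤-Reasoning
  K = unmoved x y
  kept = length (filterᵇ K (seq x))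

  upper : Δ x y ≤ d ∸ lcs (seq x) (seq y)
  upper with lcs-attained (seq x) (seq y)
  ... | zs , zs⊆x , zs⊆y , eq =
    subst (λ k → Δ x y ≤ d ∸ k) eq (m+n≤o⇒m≤o∸n (Δ x y) (Δ-sublist x y zs⊆x zs⊆y))

  lower : d ∸ lcs (seq x) (seq y) ≤ Δ x y
  lower = begin
    d ∸ lcs (seq x) (seq y)
      ≤⟨ ∸-monoʳ-≤ d (lcs-maximal K (seq x) (seq y) (unmoved-aligned x y)) ⟩
    d ∸ kept
      ≡⟨ cong (_∸ kept) (trans (sym (length-seq x)) (sym (length-filterᵇ K (seq x)))) ⟩
    kept + ∑ (dropped K) (seq x) ∸ kept
      ≡⟨ m+n∸m≡n kept _ ⟩
    ∑ (dropped K) (seq x)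
      ≡⟨ ∑-↭ (dropped K) (isPerm x) ⟩
    ∑ (dropped K) [1‥ d ]
      ≤⟨ ∑-moved≤Δ x y ⟩
    Δ x y ∎

Δ≤d : ∀ {d} (x y : Perm d) → Δ x y ≤ d
Δ≤d {d} x y = ≤-trans (≤-reflexive (Δ≡d∸lcs x y)) (m∸n≤m d (lcs (seq x) (seq y)))

-- Taking the cheapest permutation

chosen : A → A → ℕ → A
chosen x z zero    = x
chosen x z (suc _) = z

-- The second list shrinks along the recursion while costs are taken over all of `S`. Branching on a
-- truncated difference, zero when `x` costs no more, is the test that the program performs.
select : ∀ {d} → List (Perm d) → List (Perm d) → Perm d
select S []       = candidate S
select S (x ∷ xs) = chosen x (select S xs) (cost S x ∸ cost S (select S xs))

select-minimal : ∀ {d} (S T : List (Perm d)) →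
  cost S (select S T) ≤ cost S (candidate S) × All (λ x → cost S (select S T) ≤ cost S x) T
select-minimal S []      = ≤-refl , []
select-minimal S (x ∷ T) with select-minimal S T | cost S x ∸ cost S (select S T) in eq
... | ≤c , ≤T | zero  = ≤-trans x≤ ≤c , ≤-refl ∷ All.map (≤-trans x≤) ≤T
  where x≤ = m∸n≡0⇒m≤n eq
... | ≤c , ≤T | suc _ = ≤c , <⇒≤ (m∸n≢0⇒n<m (λ eq′ → case trans (sym eq) eq′ of λ ())) ∷ ≤T

-- The algorithm as a term of the fold language

pattern v₀ = ` zero
pattern v₁ = ` suc zero
pattern v₂ = ` suc (suc zero)
pattern v₃ = ` suc (suc (suc zero))
pattern v₄ = ` suc (suc (suc (suc zero)))
pattern v₅ = ` suc (suc (suc (suc (suc zero))))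

encBool : Bool → Tree
encBool true  = nil ∙ nil
encBool false = nil

`true : ∀ {k} → Tm k
`true = `nil `∙ `nil

opaque
  `monus : Tm 2
  `monus = `foldr clockD (`tl v₁) v₀ v₁

opaque
  `equal : Tm 2
  `equal =
    `if `call `monus (v₀ ∷ v₁ ∷ []) then `nil else
    `if `call `monus (v₁ ∷ v₀ ∷ []) then `nil else `true

opaque
  `max : Tm 2
  `max = `if `call `monus (v₀ ∷ v₁ ∷ []) then v₀ else v₁

opaque
  `plus : Tm 2
  `plus = `foldr clockD (`nil `∙ v₁) v₁ v₀

opaque
  `append : Tm 2
  `append = `foldr clockD (v₀ `∙ v₁) v₁ v₀

opaque
  `before : Tm 3
  `before = `foldr clockD
    (`if `call `equal (v₀ ∷ v₃ ∷ []) then `nil else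
     `if `call `equal (v₀ ∷ v₂ ∷ []) then `true else v₁)
    `nil v₂

opaque
  `majority : Tm 3
  `majority =
    `if `foldr clockS
          (`if `call `before (v₂ ∷ v₃ ∷ v₀ ∷ []) then `tl (`tl v₁) else v₁)
          (`foldr clockS (`nil `∙ v₁) `nil v₂) v₂
    then `nil else `true

opaque
  `scanStep : Tm 5
  `scanStep =
    `if v₂ then v₂ `∙ (v₁ `∙ v₃) `∙ v₄ else
    `if v₀ then (`if v₃ then (v₁ `∙ `hd v₃) `∙ `tl v₃ `∙ v₄ else `nil `∙ `nil `∙ v₁ `∙ v₄)
    else `nil `∙ (v₁ `∙ v₃) `∙ v₄

opaque
  `scan : Tm 3
  `scan = `foldr clockD
    (`call `scanStep
      (`call `majority (v₂ ∷ v₀ ∷ v₄ ∷ []) ∷ v₀ ∷ `hd v₁ ∷ `hd (`tl v₁) ∷ `tl (`tl v₁) ∷ []))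
    (`nil `∙ `nil `∙ `nil) v₁

opaque
  `insert : Tm 3
  `insert =
    `if `hd v₁
    then `call `append (`hd (`tl v₁) ∷ `tl (`tl v₁) ∷ []) `∙
         v₀ `∙ `hd (`hd v₁) `∙ `tl (`hd v₁) `∙ v₂
    else `call `append (`hd (`tl v₁) ∷ v₀ `∙ `tl (`tl v₁) ∷ []) `∙ v₂

opaque
  `symbols : Tm 1
  `symbols = `foldr clockD ((`nil `∙ `hd v₁) `∙ v₁) `nil v₀

opaque
  `order : Tm 2
  `order = `foldr clockD
    (`call `insert (v₀ ∷ `call `scan (v₀ ∷ `hd v₁ ∷ v₃ ∷ []) ∷ `tl v₁ ∷ []))
    (`nil `∙ `nil) (`call `symbols (v₀ ∷ []))

opaque
  `candidate : Tm 2
  `candidate = `call `append (`hd (`call `order (v₀ ∷ v₁ ∷ [])) ∷ `tl (`call `order (v₀ ∷ v₁ ∷ [])) ∷ [])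

opaque
  -- The second component returned is the entry of the old row just passed, the diagonal neighbour
  -- of the next cell.
  `cell : Tm 5
  `cell =
    ((v₁ `∙ `call `max (`call `max (v₂ ∷ `tl (`hd v₃) ∷ []) ∷
                        (`if `call `equal (v₀ ∷ v₁ ∷ []) then `nil `∙ v₄ else `nil) ∷ []))
     `∙ v₃) `∙ v₂

opaque
  `nextRow : Tm 2
  `nextRow = `hd (`foldr clockD
    (`call `cell (v₂ ∷ `hd v₀ ∷ `tl v₀ ∷ `hd v₁ ∷ `tl v₁ ∷ [])) (`nil `∙ `nil) v₁)

opaque
  `row : Tm 2
  `row = `foldr clockD (`call `nextRow (v₀ ∷ v₁ ∷ []))
                       -- The row of the empty sequence: every entry is `nil`, the numeral 0.
                       (`foldr clockD ((v₀ `∙ `nil) `∙ v₁) `nil v₁) v₀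

opaque
  `Δ : Tm 3
  `Δ = `call `monus (v₂ ∷ `tl (`hd (`call `row (v₀ ∷ v₁ ∷ []))) ∷ [])

opaque
  `cost : Tm 3
  `cost = `foldr clockS (`call `plus (`call `Δ (v₀ ∷ v₂ ∷ v₄ ∷ []) ∷ v₁ ∷ [])) `nil v₁

opaque
  -- A cost can reach `n * d`, beyond either clock, so `monus` cannot subtract it at once. The
  -- distances that make it up are subtracted one by one, each at most `d`.
  `excess : Tm 4
  `excess = `foldr clockS (`call `monus (v₁ ∷ `call `Δ (v₀ ∷ v₃ ∷ v₅ ∷ []) ∷ []))
                          (`call `cost (v₀ ∷ v₂ ∷ v₃ ∷ [])) v₂

opaque
  `select : Tm 2
  `select = `foldr clockS (`if `call `excess (v₀ ∷ v₁ ∷ v₂ ∷ v₃ ∷ []) then v₁ else v₀)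
                          (`call `candidate (v₁ ∷ v₀ ∷ [])) v₀

opaque
  `median : Tm 1
  `median = `call `select (`tl v₀ ∷ `hd v₀ ∷ [])

-- When the clock covers the list, a fold computes any `h` that satisfies its recursion. The
-- encoding `t` is left general because rows of the table are folded too, and they depend on the
-- whole remaining list.
foldrᵗ-spec : ∀ {f m} (P : List A → Set) (t h : List A → Tree) →
  t [] ≡ nil → (∀ {a xs} → P (a ∷ xs) → P xs) →
  (∀ a xs → P (a ∷ xs) → ∃ λ u → t (a ∷ xs) ≡ u ∙ t xs × f u (h xs) ≡ h (a ∷ xs)) →
  ∀ {xs} → P xs → length xs ≤ m → foldrᵗ m f (h []) (t xs) ≡ h xs
foldrᵗ-spec {m = zero}  P t h t[] tail step {[]}     Pxs _ = refl
foldrᵗ-spec {m = suc m} P t h t[] tail step {[]}     Pxs _ rewrite t[] = refl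
foldrᵗ-spec {f = f} {m = suc m} P t h t[] tail step {x ∷ xs} Pxs (s≤s xs≤m) with step x xs Pxs
... | u , eq , eq′ rewrite eq =
  trans (cong (f u) (foldrᵗ-spec P t h t[] tail step (tail Pxs) xs≤m)) eq′

foldrᵗ-list : ∀ {f m} (P : List A → Set) (enc : A → Tree) (h : List A → Tree) →
  (∀ {a xs} → P (a ∷ xs) → P xs) →
  (∀ a xs → P (a ∷ xs) → f (enc a) (h xs) ≡ h (a ∷ xs)) →
  ∀ {xs} → P xs → length xs ≤ m → foldrᵗ m f (h []) (encList enc xs) ≡ h xs
foldrᵗ-list P enc h tail step =
  foldrᵗ-spec P (encList enc) h refl tail (λ a xs p → _ , refl , step a xs p)

foldrᵗ-ℕ : ∀ {f m} (h : ℕ → Tree) → (∀ k → f nil (h k) ≡ h (suc k)) →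
  ∀ {k} → k ≤ m → foldrᵗ m f (h 0) (encℕ k) ≡ h k
foldrᵗ-ℕ {m = zero}  h step z≤n = refl
foldrᵗ-ℕ {m = suc m} h step z≤n = refl
foldrᵗ-ℕ {f} {suc m} h step {suc k} (s≤s k≤m) =
  trans (cong (f nil) (foldrᵗ-ℕ h step k≤m)) (step k)

right-encℕ : ∀ k → right (encℕ k) ≡ encℕ (k ∸ 1)
right-encℕ zero    = refl
right-encℕ (suc k) = refl

encConflict : Conflict → Tree
encConflict nothing        = nil
encConflict (just (w , q)) = encℕ w ∙ encℕ q

encState : ScanState → Tree
encState ⟨ c , F , T ⟩ = encConflict c ∙ encList encℕ F ∙ encList encℕ T

encLists : List ℕ × List ℕ → Tree
encLists (L , U) = encList encℕ L ∙ encList encℕ U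

-- One row of the table, indexed by the suffixes of `y`. Each entry carries the symbol of its
-- column, so a row alone suffices to build the next one.
encRow : List ℕ → List ℕ → Tree
encRow x []      = nil
encRow x (b ∷ y) = (encℕ b ∙ encℕ (lcs x (b ∷ y))) ∙ encRow x y

-- Past the end of a row, the destructors applied to `nil` give `nil`, which is the right entry 0.
encRow-head : ∀ x y → right (left (encRow x y)) ≡ encℕ (lcs x y)
encRow-head x []      = cong encℕ (sym (lcs-zeroʳ x))
encRow-head x (b ∷ y) = refl

length-front : ∀ p L → length (front (scan p L)) ≤ length L
length-front p []      = z≤n
length-front p (w ∷ L) with scan p L | length-front p L
... | ⟨ just _  , F , T ⟩ | F≤L = s≤s F≤L
... | ⟨ nothing , F , T ⟩ | F≤L with p w
length-front p (w ∷ L) | ⟨ nothing , F     , T ⟩ | F≤L | false = s≤s F≤L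
length-front p (w ∷ L) | ⟨ nothing , []    , T ⟩ | F≤L | true  = z≤n
length-front p (w ∷ L) | ⟨ nothing , q ∷ F , T ⟩ | F≤L | true  = m≤n⇒m≤1+n (≤-trans (n≤1+n _) F≤L)

-- What the clock `d` has to cover: numerals to be compared and lists to be traversed.
Bounded : ℕ → List ℕ → Set
Bounded d xs = All (_≤ d) xs × length xs ≤ d

bounded-tail : ∀ {d a xs} → Bounded d (a ∷ xs) → Bounded d xs
bounded-tail (_ ∷ ps , l) = ps , ≤-trans (n≤1+n _) l

bounded-↭ : ∀ {d xs} → xs ↭ [1‥ d ] → Bounded d xs
bounded-↭ {d} xs↭ =
  ↭.All-resp-↭ (↭-sym xs↭) (All.applyUpTo⁺₁ suc d (λ i<d → i<d)) ,
  ≤-reflexive (trans (↭.↭-length xs↭) (length-applyUpTo suc d))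

bounded-seq : ∀ {d} (x : Perm d) → Bounded d (seq x)
bounded-seq x = bounded-↭ (isPerm x)

-- The terms compute the functions analysed above

module Correctness {d : ℕ} (S : List (Perm d)) (size : Clock → ℕ)
  (d≤ : d ≤ size clockD) (n≤ : length S ≤ size clockS) where

  open Evaluation size

  opaque
    unfolding `monus

    monus-correct : ∀ a b → b ≤ d → eval `monus (encℕ a ∷ encℕ b ∷ []) ≡ encℕ (a ∸ b)
    monus-correct a b b≤d = foldrᵗ-ℕ (λ k → encℕ (a ∸ k)) step (≤-trans b≤d d≤)
      where
      step : ∀ k → right (encℕ (a ∸ k)) ≡ encℕ (a ∸ suc k)
      step k = trans (right-encℕ (a ∸ k))
                     (cong encℕ (trans (∸-+-assoc a k 1) (cong (a ∸_) (+-comm k 1))))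

  opaque
    unfolding `equal

    equal-correct : ∀ a b → a ≤ d → b ≤ d →
      eval `equal (encℕ a ∷ encℕ b ∷ []) ≡ encBool (a ≡ᵇ b)
    equal-correct a b a≤d b≤d
      rewrite monus-correct a b b≤d | monus-correct b a a≤d = compare a b
      where
      compare : ∀ a b →
        (ifᵗ encℕ (a ∸ b) then nil else ifᵗ encℕ (b ∸ a) then nil else nil ∙ nil) ≡ encBool (a ≡ᵇ b)
      compare zero    zero    = refl
      compare zero    (suc b) = refl
      compare (suc a) zero    = refl
      compare (suc a) (suc b) = compare a b

  opaque
    unfolding `max

    max-correct : ∀ a b → b ≤ d → eval `max (encℕ a ∷ encℕ b ∷ []) ≡ encℕ (a ⊔ b)
    max-correct a b b≤d rewrite monus-correct a b b≤d with a ∸ b in eq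
    ... | zero  = cong encℕ (sym (m≤n⇒m⊔n≡n (m∸n≡0⇒m≤n eq)))
    ... | suc _ = cong encℕ (sym (m≥n⇒m⊔n≡m (<⇒≤ (m∸n≢0⇒n<m λ eq′ → case trans (sym eq) eq′ of λ ()))))

  opaque
    unfolding `plus

    plus-correct : ∀ a b → a ≤ d → eval `plus (encℕ a ∷ encℕ b ∷ []) ≡ encℕ (a + b)
    plus-correct a b a≤d = foldrᵗ-ℕ (λ k → encℕ (k + b)) (λ _ → refl) (≤-trans a≤d d≤)

  opaque
    unfolding `append

    append-correct : ∀ xs ys → length xs ≤ d →
      eval `append (encList encℕ xs ∷ encList encℕ ys ∷ []) ≡ encList encℕ (xs ++ ys)
    append-correct xs ys xs≤d =
      foldrᵗ-list (λ _ → ⊤) encℕ (λ zs → encList encℕ (zs ++ ys)) _ (λ _ _ _ → refl) tt (≤-trans xs≤d d≤)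

  opaque
    unfolding `before

    before-correct : ∀ a b x → a ≤ d → b ≤ d → Bounded d x →
      eval `before (encℕ a ∷ encℕ b ∷ encList encℕ x ∷ []) ≡ encBool (before a b x)
    before-correct a b x a≤d b≤d bx =
      foldrᵗ-list (Bounded d) encℕ (λ z → encBool (before a b z)) bounded-tail step bx (≤-trans (proj₂ bx) d≤)
      where
      step : ∀ c z → Bounded d (c ∷ z) →
        (ifᵗ eval `equal (encℕ c ∷ encℕ b ∷ []) then nil else
         ifᵗ eval `equal (encℕ c ∷ encℕ a ∷ []) then nil ∙ nil else encBool (before a b z))
        ≡ encBool (before a b (c ∷ z))
      step c z (c≤d ∷ _ , _)
        rewrite equal-correct c b c≤d b≤d | equal-correct c a c≤d a≤d
        with c ≡ᵇ b | c ≡ᵇ a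
      ... | true  | _     = refl
      ... | false | true  = refl
      ... | false | false = refl

  opaque
    unfolding `majority

    majority-correct : ∀ a b → a ≤ d → b ≤ d →
      eval `majority (encℕ a ∷ encℕ b ∷ encList encPerm S ∷ []) ≡ encBool (majority S a b)
    majority-correct a b a≤d b≤d =
      trans (cong (λ t → ifᵗ t then nil else nil ∙ nil) (trans (cong (λ e → foldrᵗ (size clockS) ballot e (encList encPerm S)) count) tally))
            (test (length S ∸ 2 * votes S a b))
      where
      ballot : Tree → Tree → Tree
      ballot x r = ifᵗ eval `before (encℕ a ∷ encℕ b ∷ x ∷ []) then right (right r) else r

      test : ∀ k → (ifᵗ encℕ k then nil else nil ∙ nil) ≡ encBool (k ≡ᵇ 0)
      test zero    = refl
      test (suc k) = refl

      count : foldrᵗ (size clockS) (λ _ r → nil ∙ r) nil (encList encPerm S) ≡ encℕ (length S)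
      count = foldrᵗ-list (λ _ → ⊤) encPerm (λ T → encℕ (length T)) _ (λ _ _ _ → refl) tt n≤

      step : ∀ (x : Perm d) T → ⊤ →
        (ifᵗ eval `before (encℕ a ∷ encℕ b ∷ encPerm x ∷ [])
         then right (right (encℕ (length S ∸ 2 * votes T a b)))
         else encℕ (length S ∸ 2 * votes T a b))
        ≡ encℕ (length S ∸ 2 * votes (x ∷ T) a b)
      step x T _
        rewrite before-correct a b (seq x) a≤d b≤d (bounded-seq x)
        with before a b (seq x)
      ... | false = refl
      ... | true  = begin
        right (right (encℕ (k ∸ 2 * v)))   ≡⟨ cong right (right-encℕ (k ∸ 2 * v)) ⟩
        right (encℕ (k ∸ 2 * v ∸ 1))       ≡⟨ right-encℕ (k ∸ 2 * v ∸ 1) ⟩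
        encℕ (k ∸ 2 * v ∸ 1 ∸ 1)           ≡⟨ cong encℕ (∸-+-assoc (k ∸ 2 * v) 1 1) ⟩
        encℕ (k ∸ 2 * v ∸ 2)               ≡⟨ cong encℕ (∸-+-assoc k (2 * v) 2) ⟩
        encℕ (k ∸ (2 * v + 2))             ≡⟨ cong (λ m → encℕ (k ∸ m)) (+-comm (2 * v) 2) ⟩
        encℕ (k ∸ (2 + 2 * v))             ≡⟨ cong (λ m → encℕ (k ∸ m)) (*-suc 2 v) ⟨
        encℕ (k ∸ 2 * suc v)               ∎
        where
        open ≡-Reasoning
        k v : ℕ
        k = length S
        v = votes T a b

      tally : foldrᵗ (size clockS) ballot (encℕ (length S)) (encList encPerm S)
              ≡ encℕ (length S ∸ 2 * votes S a b)
      tally = foldrᵗ-list (λ _ → ⊤) encPerm (λ T → encℕ (length S ∸ 2 * votes T a b)) _ step tt n≤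

  opaque
    unfolding `scanStep

    scanStep-correct : ∀ p w st →
      eval `scanStep (encBool (p w) ∷ encℕ w ∷ encConflict (conflict st) ∷
                      encList encℕ (front st) ∷ encList encℕ (back st) ∷ [])
      ≡ encState (scanStep p w st)
    scanStep-correct p w ⟨ just c  , F , T ⟩ = refl
    scanStep-correct p w ⟨ nothing , F , T ⟩ with p w
    scanStep-correct p w ⟨ nothing , F     , T ⟩ | false = refl
    scanStep-correct p w ⟨ nothing , []    , T ⟩ | true  = refl
    scanStep-correct p w ⟨ nothing , q ∷ F , T ⟩ | true  = refl

  opaque
    unfolding `scan

    scan-correct : ∀ a L → a ≤ d → Bounded d L →
      eval `scan (encℕ a ∷ encList encℕ L ∷ encList encPerm S ∷ []) ≡ encState (scan (majority S a) L)
    scan-correct a L a≤d bL =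
      foldrᵗ-list (Bounded d) encℕ (λ L → encState (scan (majority S a) L)) bounded-tail step bL
        (≤-trans (proj₂ bL) d≤)
      where
      step : ∀ w L → Bounded d (w ∷ L) → let st = encState (scan (majority S a) L) in
        eval `scanStep (eval `majority (encℕ a ∷ encℕ w ∷ encList encPerm S ∷ []) ∷ encℕ w ∷
                        left st ∷ left (right st) ∷ right (right st) ∷ [])
        ≡ encState (scan (majority S a) (w ∷ L))
      step w L (w≤d ∷ _ , _) rewrite majority-correct a w a≤d w≤d =
        scanStep-correct (majority S a) w (scan (majority S a) L)

  opaque
    unfolding `insert

    insert-correct : ∀ a st U → length (front st) ≤ d →
      eval `insert (encℕ a ∷ encState st ∷ encList encℕ U ∷ []) ≡ encLists (insert a st U)
    insert-correct a ⟨ nothing      , F , T ⟩ U F≤d =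
      cong (_∙ encList encℕ U) (append-correct F (a ∷ T) F≤d)
    insert-correct a ⟨ just (w , q) , F , T ⟩ U F≤d =
      cong (_∙ encList encℕ (a ∷ w ∷ q ∷ U)) (append-correct F T F≤d)

  opaque
    unfolding `symbols

    symbols-correct : eval `symbols (encℕ d ∷ []) ≡ encList encℕ (symbols d)
    symbols-correct = foldrᵗ-ℕ (λ k → encList encℕ (symbols k)) step d≤
      where
      step : ∀ k → (nil ∙ left (encList encℕ (symbols k))) ∙ encList encℕ (symbols k) ≡
                   encList encℕ (symbols (suc k))
      -- On the empty list `left` gives `nil`, the numeral 0, so the first symbol is 1.
      step zero    = refl
      step (suc k) = refl

  opaque
    unfolding `order

    order-correct : eval `order (encℕ d ∷ encList encPerm S ∷ []) ≡ encLists (arrangement S)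
    order-correct = trans (cong (foldrᵗ (size clockD) place (nil ∙ nil)) symbols-correct)
      (foldrᵗ-list P encℕ (λ xs → encLists (order (majority S) xs))
        (λ { (_ ∷ u , b) → u , bounded-tail b }) step
        (unique-symbols d , bounded-↭ (symbols-↭ d))
        (≤-trans (proj₂ (bounded-↭ (symbols-↭ d))) d≤))
      where
      place : Tree → Tree → Tree
      place a r = eval `insert
        (a ∷ eval `scan (a ∷ left r ∷ encList encPerm S ∷ []) ∷ right r ∷ [])

      P : List ℕ → Set
      P xs = Unique xs × Bounded d xs

      step : ∀ a xs → P (a ∷ xs) → let L = proj₁ (order (majority S) xs) in
        eval `insert (encℕ a ∷ eval `scan (encℕ a ∷ encList encℕ L ∷ encList encPerm S ∷ []) ∷
                      encList encℕ (proj₂ (order (majority S) xs)) ∷ [])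
        ≡ encLists (order (majority S) (a ∷ xs))
      step a xs (_ ∷ u , b@(a≤d ∷ _ , _)) =
        trans (cong (λ t → eval `insert (encℕ a ∷ t ∷ encList encℕ U ∷ [])) (scan-correct a L a≤d boundedL))
              (insert-correct a (scan (majority S a) L) U
                (≤-trans (length-front (majority S a) L) (proj₂ boundedL)))
        where
        L U : List ℕ
        L = proj₁ (order (majority S) xs)
        U = proj₂ (order (majority S) xs)
        L++U↭xs : L ++ U ↭ xs
        L++U↭xs = order-↭ (majority S) u
        boundedL : Bounded d L
        boundedL = All.++⁻ˡ L (↭.All-resp-↭ (↭-sym L++U↭xs) (proj₁ (bounded-tail b))) , (begin
          length L          ≤⟨ m≤m+n (length L) _ ⟩
          length L + _      ≡⟨ length-++ L ⟨
          length (L ++ _)   ≡⟨ ↭.↭-length L++U↭xs ⟩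
          length xs         ≤⟨ proj₂ (bounded-tail b) ⟩
          d                 ∎)
          where open ≤-Reasoning

  opaque
    unfolding `candidate

    candidate-correct : eval `candidate (encℕ d ∷ encList encPerm S ∷ []) ≡ encPerm (candidate S)
    candidate-correct =
      trans (cong (λ t → eval `append (left t ∷ right t ∷ [])) order-correct)
        (append-correct L U (begin
          length L                     ≤⟨ m≤m+n (length L) (length U) ⟩
          length L + length U          ≡⟨ length-++ L ⟨
          length (L ++ U)              ≡⟨ length-seq (candidate S) ⟩
          d                            ∎))
      where
      open ≤-Reasoning
      L U : List ℕ
      L = proj₁ (arrangement S)
      U = proj₂ (arrangement S)

  opaque
    unfolding `cell

    cell-correct : ∀ a b x y → a ≤ d → Bounded d (b ∷ y) →
      eval `cell (encℕ a ∷ encℕ b ∷ encℕ (lcs x (b ∷ y)) ∷ encRow (a ∷ x) y ∷ encℕ (lcs x y) ∷ [])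
      ≡ encRow (a ∷ x) (b ∷ y) ∙ encℕ (lcs x (b ∷ y))
    cell-correct a b x y a≤d (b≤d ∷ _ , y<d)
      rewrite encRow-head (a ∷ x) y
            | max-correct (lcs x (b ∷ y)) (lcs (a ∷ x) y) (≤-trans (lcs≤length (a ∷ x) y) (<⇒≤ y<d))
            | equal-correct a b a≤d b≤d =
      cong (λ t → ((encℕ b ∙ t) ∙ encRow (a ∷ x) y) ∙ encℕ (lcs x (b ∷ y))) last-max
      where
      l : ℕ
      l = lcs x (b ∷ y) ⊔ lcs (a ∷ x) y
      last-max : eval `max (encℕ l ∷ (ifᵗ encBool (a ≡ᵇ b) then nil ∙ encℕ (lcs x y) else nil) ∷ [])
                 ≡ encℕ (l ⊔ (if a ≡ᵇ b then suc (lcs x y) else 0))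
      last-max with a ≡ᵇ b
      ... | true  = max-correct l (suc (lcs x y)) (≤-trans (s≤s (lcs≤length x y)) y<d)
      ... | false = max-correct l 0 z≤n

  opaque
    unfolding `nextRow

    nextRow-correct : ∀ a x y → a ≤ d → Bounded d y →
      eval `nextRow (encℕ a ∷ encRow x y ∷ []) ≡ encRow (a ∷ x) y
    nextRow-correct a x y a≤d by = cong left (begin
      foldrᵗ (size clockD) f (nil ∙ nil) (encRow x y)
        ≡⟨ cong (λ t → foldrᵗ (size clockD) f (nil ∙ encℕ t) (encRow x y)) (lcs-zeroʳ x) ⟨
      foldrᵗ (size clockD) f (h []) (encRow x y)
        ≡⟨ foldrᵗ-spec (Bounded d) (encRow x) h refl bounded-tail
             (λ b z bz → _ , refl , cell-correct a b x z a≤d bz) by (≤-trans (proj₂ by) d≤) ⟩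
      h y ∎)
      where
      open ≡-Reasoning
      f : Tree → Tree → Tree
      f s r = eval `cell (encℕ a ∷ left s ∷ right s ∷ left r ∷ right r ∷ [])
      h : List ℕ → Tree
      h z = encRow (a ∷ x) z ∙ encℕ (lcs x z)

  opaque
    unfolding `row

    row-correct : ∀ x y → Bounded d x → Bounded d y →
      eval `row (encList encℕ x ∷ encList encℕ y ∷ []) ≡ encRow x y
    row-correct x y bx by
      rewrite foldrᵗ-list {f = λ b r → (b ∙ nil) ∙ r} (λ _ → ⊤) encℕ (encRow [])
                _ (λ _ _ _ → refl) {y} tt (≤-trans (proj₂ by) d≤) =
      foldrᵗ-list (Bounded d) encℕ (λ z → encRow z y) bounded-tail
        (λ { a z (a≤d ∷ _ , _) → nextRow-correct a z y a≤d by }) bx (≤-trans (proj₂ bx) d≤)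

  opaque
    unfolding `Δ

    Δ-correct : ∀ (x y : Perm d) → eval `Δ (encPerm x ∷ encPerm y ∷ encℕ d ∷ []) ≡ encℕ (Δ x y)
    Δ-correct x y = begin
      eval `monus (encℕ d ∷ right (left (eval `row (encPerm x ∷ encPerm y ∷ []))) ∷ [])
        ≡⟨ cong (λ t → eval `monus (encℕ d ∷ right (left t) ∷ []))
             (row-correct (seq x) (seq y) (bounded-seq x) (bounded-seq y)) ⟩
      eval `monus (encℕ d ∷ right (left (encRow (seq x) (seq y))) ∷ [])
        ≡⟨ cong (λ t → eval `monus (encℕ d ∷ t ∷ [])) (encRow-head (seq x) (seq y)) ⟩
      eval `monus (encℕ d ∷ encℕ (lcs (seq x) (seq y)) ∷ [])
        ≡⟨ monus-correct d _ (≤-trans (lcs≤length (seq x) (seq y)) (≤-reflexive (length-seq y))) ⟩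
      encℕ (d ∸ lcs (seq x) (seq y))
        ≡⟨ cong encℕ (Δ≡d∸lcs x y) ⟨
      encℕ (Δ x y) ∎
      where open ≡-Reasoning

  opaque
    unfolding `cost

    cost-correct : ∀ z →
      eval `cost (encPerm z ∷ encList encPerm S ∷ encℕ d ∷ []) ≡ encℕ (cost S z)
    cost-correct z = foldrᵗ-list (λ _ → ⊤) encPerm (λ T → encℕ (cost T z)) _ step tt n≤
      where
      step : ∀ (x : Perm d) T → ⊤ →
        eval `plus (eval `Δ (encPerm x ∷ encPerm z ∷ encℕ d ∷ []) ∷ encℕ (cost T z) ∷ [])
        ≡ encℕ (cost (x ∷ T) z)
      step x T _ = trans (cong (λ t → eval `plus (t ∷ encℕ (cost T z) ∷ [])) (Δ-correct x z))
                         (plus-correct (Δ x z) (cost T z) (Δ≤d x z))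

  opaque
    unfolding `excess

    excess-correct : ∀ z w →
      eval `excess (encPerm z ∷ encPerm w ∷ encList encPerm S ∷ encℕ d ∷ [])
      ≡ encℕ (cost S z ∸ cost S w)
    excess-correct z w =
      trans (cong (λ e → foldrᵗ (size clockS) lower e (encList encPerm S)) (cost-correct z))
            (foldrᵗ-list (λ _ → ⊤) encPerm (λ T → encℕ (cost S z ∸ cost T w)) _ step tt n≤)
      where
      lower : Tree → Tree → Tree
      lower x r = eval `monus (r ∷ eval `Δ (x ∷ encPerm w ∷ encℕ d ∷ []) ∷ [])

      step : ∀ (x : Perm d) T → ⊤ →
        eval `monus (encℕ (cost S z ∸ cost T w) ∷ eval `Δ (encPerm x ∷ encPerm w ∷ encℕ d ∷ []) ∷ [])
        ≡ encℕ (cost S z ∸ cost (x ∷ T) w)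
      step x T _ =
        trans (cong (λ t → eval `monus (encℕ (cost S z ∸ cost T w) ∷ t ∷ [])) (Δ-correct x w))
        (trans (monus-correct (cost S z ∸ cost T w) (Δ x w) (Δ≤d x w))
               (cong encℕ (trans (∸-+-assoc (cost S z) (cost T w) (Δ x w))
                                 (cong (cost S z ∸_) (+-comm (cost T w) (Δ x w))))))

  opaque
    unfolding `select

    select-correct : eval `select (encList encPerm S ∷ encℕ d ∷ []) ≡ encPerm (select S S)
    select-correct =
      trans (cong (λ e → foldrᵗ (size clockS) keep e (encList encPerm S)) candidate-correct)
            (foldrᵗ-list (λ _ → ⊤) encPerm (λ T → encPerm (select S T)) _ step tt n≤)
      where
      keep : Tree → Tree → Tree
      keep x r = ifᵗ eval `excess (x ∷ r ∷ encList encPerm S ∷ encℕ d ∷ []) then r else x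

      step : ∀ (x : Perm d) T → ⊤ →
        (ifᵗ eval `excess (encPerm x ∷ encPerm (select S T) ∷ encList encPerm S ∷ encℕ d ∷ [])
         then encPerm (select S T) else encPerm x)
        ≡ encPerm (select S (x ∷ T))
      step x T _ = trans (cong (λ t → ifᵗ t then encPerm (select S T) else encPerm x)
                               (excess-correct x (select S T)))
                         (branch (cost S x ∸ cost S (select S T)))
        where
        branch : ∀ e → (ifᵗ encℕ e then encPerm (select S T) else encPerm x)
                       ≡ encPerm (chosen x (select S T) e)
        branch zero    = refl
        branch (suc _) = refl

  opaque
    unfolding `median

    median-correct : eval `median (encInput d S ∷ []) ≡ encPerm (select S S)
    median-correct = select-correct

-- The time bound in n and d, and the ratio 1.999

spine-encℕ : ∀ k → spine (encℕ k) ≡ k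
spine-encℕ zero    = refl
spine-encℕ (suc k) = cong suc (spine-encℕ k)

spine-encList : ∀ (enc : A → Tree) xs → spine (encList enc xs) ≡ length xs
spine-encList enc []       = refl
spine-encList enc (x ∷ xs) = cong suc (spine-encList enc xs)

-- Opened only here, since +_ makes the sections (m +_) above ambiguous.
open import Data.Integer using (+_)

select-approximates : ∀ {d} (S : List (Perm d)) → IsApproxMedian (+ 1999 / 1000) S (select S S)
select-approximates S y = *≤* (subst₂ ℤ._≤_ (ℤ.pos-* c 1000) numerator (ℤ.+≤+ c≤q))
  where
  open Analysis S y using (approximation)

  c q : ℕ
  c = cost S (select S S)
  q = cost S y

  numerator : + (1999 * q) ≡ + 1999 ℤ.* + q ℤ.* + 1
  numerator = trans (ℤ.pos-* 1999 q) (sym (ℤ.*-identityʳ (+ 1999 ℤ.* + q)))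

  c≤q : c * 1000 ≤ 1999 * q
  c≤q = *-cancelˡ-≤ 49 (begin
    49 * (c * 1000)   ≡⟨ *-assoc 49 c 1000 ⟨
    49 * c * 1000     ≡⟨ *-comm (49 * c) 1000 ⟩
    1000 * (49 * c)   ≤⟨ *-monoʳ-≤ 1000 (approximation (select S S) (proj₂ minimal) (proj₁ minimal)) ⟩
    1000 * (97 * q)   ≡⟨ *-assoc 1000 97 q ⟨
    -- `97951 = 49 * 1999`, so 951 is the slack of 97/49 below 1.999.
    97000 * q         ≤⟨ *-monoˡ-≤ q (m≤m+n 97000 951) ⟩
    97951 * q         ≡⟨ *-assoc 49 1999 q ⟩
    49 * (1999 * q)   ∎)
    where
    open ≤-Reasoning
    minimal = select-minimal S S

theorem3p1 : ∃ λ (c : Cmd) → PolyTimeApproxMedian (+ 1999 / 1000) c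
theorem3p1 = program `median , polynomial , λ n d S len _ →
  select S S , computes n d S len , select-approximates S
  where
  polynomial : Poly
  polynomial = bound `median ⊕ const 2

  computes : ∀ n d (S : List (Perm d)) → length S ≡ n →
    Computes (program `median) (encInput d S) (encPerm (select S S)) (evalPoly polynomial n d)
  computes n d S refl =
    -- The variables of the polynomial are the lengths of the clocks, which the encoding makes equal
    -- to `n` and `d`.
    subst₂ (λ k l → Computes (program `median) (encInput d S) (encPerm (select S S))
                             (evalPoly polynomial k l))
      (spine-encList encPerm S) (spine-encℕ d)
      (subst (λ t → Computes (program `median) (encInput d S) t (evalPoly polynomial Compiled.n Compiled.d))
        (Correctness.median-correct S Compiled.size
          (≤-reflexive (sym (spine-encℕ d))) (≤-reflexive (sym (spine-encList encPerm S))))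
        (Compiled.program-computes `median))
    where
    module Compiled = Compilation (encInput d S)
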